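{- Let $a$ be a fixed odd natural number. For each positive integer $n$, let $n$ mobile sensors be placed independently and uniformly at random in $[0,1]$, let $X_1\le X_2\le\dots\le X_n$ be their positions in increasing order (so $X_i$ is the $i$-th order statistic), and let $t_i=\frac{i}{n}-\frac{1}{2n}$ for $i=1,\dots,n$. Then the expected sum of displacements to the power $a$ when the $i$-th sensor moves from $X_i$ to the anchor location $t_i$, for $i=1,\dots,n$, satisfies $$\sum_{i=1}^{n}\mathbf{E}\left[|X_i-t_i|^a\right]\in\Theta\left(\frac{1}{n^{\frac{a}{2}-1}}\right)\qquad (n\to\infty).$$
   Context: The implied constants in $\Theta(\cdot)$ may depend on $a$ but not on $n$. -}

module Defs where

open import Data.Fin.Base as Fin using (Fin; zero; suc; toℕ; combine)
import Data.Fin.Properties as Fin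
open import Data.Integer.Base as ℤ using (ℤ; +_; -[1+_])
import Data.Integer.Properties as ℤ
open import Data.List.Base as List using (List; []; _∷_)
open import Data.List.Relation.Binary.Permutation.Propositional
  using (_↭_; ↭-refl; ↭-sym; ↭-trans; ↭⇒↭ₛ; prep; swap)
open import Data.List.Relation.Binary.Permutation.Propositional.Properties
  using (↭-length)
import Data.List.Relation.Binary.Pointwise as ListPointwise
open import Data.List.Relation.Unary.Linked as Linked using ([]; [-]; _∷_)
open import Data.Nat.Base as ℕ using (ℕ; zero; suc; NonZero; s≤s; z≤n)
import Data.Nat.DivMod as ℕ
import Data.Nat.Properties as ℕ
open import Data.Product.Base using (∃; _×_; _,_)
open import Data.Rational.Base as ℚ hiding (NonZero)
open import Data.Rational.Properties
import Data.Rational.Unnormalised.Base as ℚᵘ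
import Data.Rational.Unnormalised.Properties as ℚᵘ
open import Data.Sum.Base using (inj₁; inj₂)
open import Data.Vec.Base as Vec using (Vec; []; _∷_; toList)
open import Function.Base using (_$_)
import Data.Vec.Functional as Vector
import Data.Vec.Properties as Vec
open import Data.Vec.Relation.Binary.Pointwise.Inductive as Pointwise
  using (Pointwise; []; _∷_)
open import Data.Vec.Relation.Unary.All as All using (All; []; _∷_)
import Data.Vec.Relation.Unary.All.Properties as All
open import Relation.Binary.PropositionalEquality
open import Relation.Binary.Bundles using (DecTotalOrder)
open import Relation.Nullary using (yes; no; contradiction)

open import Algebra.Bundles using (CommutativeRing)
open import Algebra.Properties.Semiring.Sum
  (CommutativeRing.semiring +-*-commutativeRing)
  using (sum; ∑-distrib-+; *-distribˡ-sum)
open import Algebra.Definitions.RawSemiring +-*-rawSemiring public using (_^_)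
open import Data.List.Sort ≤-decTotalOrder using (sort; sort-↭; sort-↗)
open import Data.List.Relation.Unary.Sorted.TotalOrder (DecTotalOrder.totalOrder ≤-decTotalOrder) using (Sorted)
open import Data.List.Relation.Unary.Sorted.TotalOrder.Properties using (↗↭↗⇒≋)
open import Data.Rational.Solver using (module +-*-Solver)
import Data.Nat.Solver
open Data.Nat.Solver.+-*-Solver using ()
  renaming (solve to solveℕ; _:=_ to _:≡_; _:*_ to _:×_)
open +-*-Solver using (solve; _:=_; _:+_; _:*_; _:-_; con)

------------------------------------------------------------------------
-- Rational arithmetic

module Arithmetic where

  /-≤ : ∀ a b c d .{{_ : NonZero b}} .{{_ : NonZero d}} →
        a ℕ.* d ℕ.≤ c ℕ.* b → + a / b ≤ + c / d
  /-≤ a (suc b) c (suc d) h = toℚᵘ-cancel-≤ (begin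
    toℚᵘ (+ a / suc b)   ≃⟨ toℚᵘ-fromℚᵘ (+ a ℚᵘ./ suc b) ⟩
    + a ℚᵘ./ suc b       ≤⟨ ℚᵘ.*≤* (subst₂ ℤ._≤_ (ℤ.pos-* a (suc d)) (ℤ.pos-* c (suc b)) (ℤ.+≤+ h)) ⟩
    + c ℚᵘ./ suc d       ≃⟨ ℚᵘ.≃-sym (toℚᵘ-fromℚᵘ (+ c ℚᵘ./ suc d)) ⟩
    toℚᵘ (+ c / suc d)   ∎)
    where open ℚᵘ.≤-Reasoning

  /-+ : ∀ a b n .{{_ : NonZero n}} → + (a ℕ.+ b) / n ≡ + a / n + + b / n
  /-+ a b (suc n) = toℚᵘ-injective (begin
    toℚᵘ (+ (a ℕ.+ b) / suc n)                ≈⟨ toℚᵘ-fromℚᵘ (+ (a ℕ.+ b) ℚᵘ./ suc n) ⟩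
    + (a ℕ.+ b) ℚᵘ./ suc n                    ≈⟨ ℚᵘ.*≡* eq ⟩
    + a ℚᵘ./ suc n ℚᵘ.+ + b ℚᵘ./ suc n        ≈⟨ ℚᵘ.≃-sym (ℚᵘ.+-cong (toℚᵘ-fromℚᵘ (+ a ℚᵘ./ suc n)) (toℚᵘ-fromℚᵘ (+ b ℚᵘ./ suc n))) ⟩
    toℚᵘ (+ a / suc n) ℚᵘ.+ toℚᵘ (+ b / suc n) ≈⟨ ℚᵘ.≃-sym (toℚᵘ-homo-+ (+ a / suc n) (+ b / suc n)) ⟩
    toℚᵘ (+ a / suc n + + b / suc n)          ∎)
    where
    open ℚᵘ.≃-Reasoning
    N = + suc n
    eq : + (a ℕ.+ b) ℤ.* (N ℤ.* N) ≡ (+ a ℤ.* N ℤ.+ + b ℤ.* N) ℤ.* N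
    eq = trans (sym (ℤ.*-assoc (+ (a ℕ.+ b)) N N))
               (cong (ℤ._* N) (ℤ.*-distribʳ-+ N (+ a) (+ b)))

  0≤/ : ∀ a n .{{_ : NonZero n}} → 0ℚ ≤ + a / n
  0≤/ a n = nonNegative⁻¹ (+ a / n) {{normalize-nonNeg a n}}

  n/n≡1 : ∀ n .{{_ : NonZero n}} → + n / n ≡ 1ℚ
  n/n≡1 n@(suc _) = ≤-antisym
    (/-≤ n n 1 1 (ℕ.≤-reflexive (ℕ.*-comm n 1))) (/-≤ 1 1 n n (ℕ.≤-reflexive (ℕ.*-comm 1 n)))

  *-monoˡ : ∀ {r p q} → 0ℚ ≤ r → p ≤ q → r * p ≤ r * q
  *-monoˡ {r} 0≤r = *-monoˡ-≤-nonNeg r {{nonNegative 0≤r}}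

  *-monoʳ : ∀ {r p q} → 0ℚ ≤ r → p ≤ q → p * r ≤ q * r
  *-monoʳ {r} 0≤r = *-monoʳ-≤-nonNeg r {{nonNegative 0≤r}}

  0≤* : ∀ {p q} → 0ℚ ≤ p → 0ℚ ≤ q → 0ℚ ≤ p * q
  0≤* {p} 0≤p 0≤q = ≤-trans (≤-reflexive (sym (*-zeroʳ p))) (*-monoˡ 0≤p 0≤q)

  0≤+ : ∀ {p q} → 0ℚ ≤ p → 0ℚ ≤ q → 0ℚ ≤ p + q
  0≤+ 0≤p 0≤q = +-mono-≤ 0≤p 0≤q

  0<* : ∀ {p q} → 0ℚ < p → 0ℚ < q → 0ℚ < p * q
  0<* {p} {q} 0<p 0<q =
    positive⁻¹ _ {{pos*pos⇒pos p {{positive 0<p}} q {{positive 0<q}}}}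

  0<½ : 0ℚ < ½
  0<½ = positive⁻¹ ½

  halves : ∀ ε → ½ * ε + ½ * ε ≡ ε
  halves ε = trans (sym (*-distribʳ-+ ε ½ ½)) (*-identityˡ ε)

  archimedean : ∀ {ε} → 0ℚ < ε → + 1 / ↧ₙ ε ≤ ε
  archimedean {ε} 0<ε = subst (+ 1 / ↧ₙ ε ≤_) (↥p/↧p≡p ε) (go ε (positive 0<ε))
    where
    go : ∀ p → Positive p → + 1 / ↧ₙ p ≤ ↥ p / ↧ₙ p
    go (mkℚ (+ suc n) d _) _ = /-≤ 1 (suc d) (suc n) (suc d) (ℕ.*-monoˡ-≤ (suc d) {1} {suc n} (s≤s z≤n))

  -- A record, so that Agda can infer its parameters.
  record Close (δ x y : ℚ) : Set where
    constructor close
    field far : ∣ x - y ∣ ≤ δ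

  open Close public

  p≤∣p∣ : ∀ p → p ≤ ∣ p ∣
  p≤∣p∣ p with ≤-total 0ℚ p
  ... | inj₁ 0≤p = ≤-reflexive (sym (0≤p⇒∣p∣≡p 0≤p))
  ... | inj₂ p≤0 = ≤-trans p≤0 (0≤∣p∣ p)

  ∣-∣-comm : ∀ x y → ∣ x - y ∣ ≡ ∣ y - x ∣
  ∣-∣-comm x y = trans (cong ∣_∣ (solve 2 (λ x y → x :- y := con 0ℚ :- (y :- x)) refl x y))
    (trans (cong ∣_∣ (+-identityˡ (- (y - x)))) (∣-p∣≡∣p∣ (y - x)))

  close-≤ : ∀ {δ x y} → Close δ x y → x ≤ y + δ
  close-≤ {δ} {x} {y} (close h) = begin
    x             ≡⟨ solve 2 (λ x y → x := y :+ (x :- y)) refl x y ⟩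
    y + (x - y)   ≤⟨ +-monoʳ-≤ y (≤-trans (p≤∣p∣ (x - y)) h) ⟩
    y + δ         ∎
    where open ≤-Reasoning

  close-sym : ∀ {δ x y} → Close δ x y → Close δ y x
  close-sym {x = x} {y} (close h) = close (≤-trans (≤-reflexive (∣-∣-comm y x)) h)

  ≤-close : ∀ {δ x y} → x ≤ y + δ → y ≤ x + δ → Close δ x y
  ≤-close {δ} {x} {y} h₁ h₂ with ∣p∣≡p∨∣p∣≡-p (x - y)
  ... | inj₁ eq = close $ ≤-trans (≤-reflexive eq) (begin
    x - y        ≤⟨ +-monoˡ-≤ (- y) h₁ ⟩
    y + δ - y    ≡⟨ solve 2 (λ y δ → y :+ δ :- y := δ) refl y δ ⟩
    δ            ∎)
    where open ≤-Reasoning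
  ... | inj₂ eq = close $ ≤-trans (≤-reflexive eq) (begin
    - (x - y)    ≡⟨ trans (sym (+-identityˡ _)) (solve 2 (λ x y → con 0ℚ :- (x :- y) := y :- x) refl x y) ⟩
    y - x        ≤⟨ +-monoˡ-≤ (- x) h₂ ⟩
    x + δ - x    ≡⟨ solve 2 (λ y δ → y :+ δ :- y := δ) refl x δ ⟩
    δ            ∎)
    where open ≤-Reasoning

  close-trans : ∀ {δ ε x y z} → Close δ x y → Close ε y z → Close (δ + ε) x z
  close-trans {δ} {ε} {x} {y} {z} (close h₁) (close h₂) = close $ begin
    ∣ x - z ∣               ≡⟨ cong ∣_∣ (solve 3 (λ x y z → x :- z := x :- y :+ (y :- z)) refl x y z) ⟩
    ∣ (x - y) + (y - z) ∣   ≤⟨ ∣p+q∣≤∣p∣+∣q∣ (x - y) (y - z) ⟩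
    ∣ x - y ∣ + ∣ y - z ∣   ≤⟨ +-mono-≤ h₁ h₂ ⟩
    δ + ε                   ∎
    where open ≤-Reasoning

open Arithmetic

------------------------------------------------------------------------
-- Real numbers, as Cauchy sequences of rationals

record ℝ : Set where
  field
    seq    : ℕ → ℚ
    cauchy : ∀ ε → 0ℚ < ε →
             ∃ λ N → ∀ k l → N ℕ.≤ k → N ℕ.≤ l → ∣ seq k - seq l ∣ ≤ ε

open ℝ public

infix 4 _≤ᴿ_
_≤ᴿ_ : ℝ → ℝ → Set
x ≤ᴿ y = ∀ ε → 0ℚ < ε → ∃ λ N → ∀ k → N ℕ.≤ k → seq x k ≤ seq y k + ε

0ᴿ : ℝ
0ᴿ .seq _ = 0ℚ
0ᴿ .cauchy ε 0<ε = 0 , λ _ _ _ _ → <⇒≤ 0<ε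

infixl 6 _+ᴿ_
_+ᴿ_ : ℝ → ℝ → ℝ
(x +ᴿ y) .seq k = seq x k + seq y k
(x +ᴿ y) .cauchy ε 0<ε =
  let N₁ , h₁ = cauchy x (½ * ε) (0<* 0<½ 0<ε)
      N₂ , h₂ = cauchy y (½ * ε) (0<* 0<½ 0<ε)
  in N₁ ℕ.⊔ N₂ , λ k l N≤k N≤l → begin
    ∣ (seq x k + seq y k) - (seq x l + seq y l) ∣
      ≡⟨ cong ∣_∣ (solve 4 (λ a b c d → (a :+ b) :- (c :+ d) := (a :- c) :+ (b :- d)) refl (seq x k) (seq y k) (seq x l) (seq y l)) ⟩
    ∣ (seq x k - seq x l) + (seq y k - seq y l) ∣
      ≤⟨ ∣p+q∣≤∣p∣+∣q∣ (seq x k - seq x l) (seq y k - seq y l) ⟩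
    ∣ seq x k - seq x l ∣ + ∣ seq y k - seq y l ∣
      ≤⟨ +-mono-≤ (h₁ k l (ℕ.m⊔n≤o⇒m≤o N₁ N₂ N≤k) (ℕ.m⊔n≤o⇒m≤o N₁ N₂ N≤l))
                  (h₂ k l (ℕ.m⊔n≤o⇒n≤o N₁ N₂ N≤k) (ℕ.m⊔n≤o⇒n≤o N₁ N₂ N≤l)) ⟩
    ½ * ε + ½ * ε
      ≡⟨ halves ε ⟩
    ε ∎
  where open ≤-Reasoning

∑ᴿ : ∀ {n} → (Fin n → ℝ) → ℝ
∑ᴿ = Vector.foldr _+ᴿ_ 0ᴿ

module Division where
  divide : ∀ B ε → 0ℚ ≤ B → 0ℚ < ε → ∃ λ δ → 0ℚ < δ × B * δ ≤ ε
  divide B ε 0≤B 0<ε = δ , 0<δ , (begin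
    B * δ                    ≤⟨ *-monoʳ (<⇒≤ 0<δ) (≤-trans (≤-reflexive (sym (+-identityʳ B))) (+-monoʳ-≤ B (<⇒≤ (positive⁻¹ 1ℚ)))) ⟩
    (B + 1ℚ) * (1/c * ε)     ≡⟨ sym (*-assoc (B + 1ℚ) 1/c ε) ⟩
    (B + 1ℚ) * 1/c * ε       ≡⟨ cong (_* ε) (*-inverseʳ (B + 1ℚ)) ⟩
    1ℚ * ε                   ≡⟨ *-identityˡ ε ⟩
    ε                        ∎)
    where
    open ≤-Reasoning
    instance
      positive-c : Positive (B + 1ℚ)
      positive-c = nonNeg+pos⇒pos B {{nonNegative 0≤B}} 1ℚ
      nonZero-c : ℚ.NonZero (B + 1ℚ)
      nonZero-c = pos⇒nonZero (B + 1ℚ)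
    1/c = 1/ (B + 1ℚ)
    δ = 1/c * ε
    0<δ = 0<* (positive⁻¹ 1/c {{1/pos⇒pos (B + 1ℚ)}}) 0<ε

open Division

infixr 7 _·ᴿ_
_·ᴿ_ : ℚ → ℝ → ℝ
(c ·ᴿ x) .seq k = c * seq x k
(c ·ᴿ x) .cauchy ε 0<ε =
  let δ , 0<δ , cδ≤ε = divide ∣ c ∣ ε (0≤∣p∣ c) 0<ε
      N , h = cauchy x δ 0<δ
  in N , λ k l N≤k N≤l → begin
    ∣ c * seq x k - c * seq x l ∣
      ≡⟨ cong ∣_∣ (solve 3 (λ c a b → c :* a :- c :* b := c :* (a :- b)) refl c (seq x k) (seq x l)) ⟩
    ∣ c * (seq x k - seq x l) ∣
      ≡⟨ ∣p*q∣≡∣p∣*∣q∣ c (seq x k - seq x l) ⟩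
    ∣ c ∣ * ∣ seq x k - seq x l ∣
      ≤⟨ *-monoˡ (0≤∣p∣ c) (h k l N≤k N≤l) ⟩
    ∣ c ∣ * δ
      ≤⟨ cδ≤ε ⟩
    ε ∎
  where open ≤-Reasoning

------------------------------------------------------------------------
-- Square roots

isqrt-step : ℕ → ℕ → ℕ
isqrt-step m r with suc r ℕ.* suc r ℕ.≤? m
... | yes _ = suc r
... | no  _ = r

-- ⌊√m⌋
isqrt : ℕ → ℕ
isqrt zero    = 0
isqrt (suc m) = isqrt-step (suc m) (isqrt m)

module Isqrt where
  isqrt-≤ : ∀ m → isqrt m ℕ.* isqrt m ℕ.≤ m
  isqrt-≤ zero    = z≤n
  isqrt-≤ (suc m) with suc (isqrt m) ℕ.* suc (isqrt m) ℕ.≤? suc m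
  ... | yes h = h
  ... | no  _ = ℕ.m≤n⇒m≤1+n (isqrt-≤ m)

  isqrt-> : ∀ m → m ℕ.< suc (isqrt m) ℕ.* suc (isqrt m)
  isqrt-> zero    = s≤s z≤n
  isqrt-> (suc m) with suc (isqrt m) ℕ.* suc (isqrt m) ℕ.≤? suc m
  ... | yes h = ℕ.<-≤-trans (s≤s (isqrt-> m)) (ℕ.*-mono-< {suc r} {suc (suc r)} {suc r} {suc (suc r)} ℕ.≤-refl ℕ.≤-refl)
    where r = isqrt m
  ... | no ¬h = ℕ.≰⇒> ¬h

open Isqrt

module _ (q : ℚ) where

  -- ⌊K√q⌋ / K where K = k + 1, using ⌊K√q⌋ = ⌊√⌊qK²⌋⌋.
  √-num : ℕ → ℕ
  √-num k = isqrt ((ℤ.∣ ↥ q ∣ ℕ.* (suc k ℕ.* suc k)) ℕ./ ↧ₙ q)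

  √-seq : ℕ → ℚ
  √-seq k = + √-num k / suc k

  module √-Bounds where
    p = ℤ.∣ ↥ q ∣
    d = ↧ₙ q

    lower : ∀ k → √-num k ℕ.* √-num k ℕ.* d ℕ.≤ p ℕ.* (suc k ℕ.* suc k)
    lower k = ℕ.≤-trans (ℕ.*-monoˡ-≤ d (isqrt-≤ (m ℕ./ d))) (ℕ.m/n*n≤m m d)
      where m = p ℕ.* (suc k ℕ.* suc k)

    upper : ∀ k → p ℕ.* (suc k ℕ.* suc k) ℕ.< suc (√-num k) ℕ.* suc (√-num k) ℕ.* d
    upper k = begin-strict
      m                          ≡⟨ ℕ.m≡m%n+[m/n]*n m d ⟩
      m ℕ.% d ℕ.+ m ℕ./ d ℕ.* d  <⟨ ℕ.+-monoˡ-< _ (ℕ.m%n<n m d) ⟩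
      suc (m ℕ./ d) ℕ.* d        ≤⟨ ℕ.*-monoˡ-≤ d (isqrt-> (m ℕ./ d)) ⟩
      _                          ∎
      where
      open ℕ.≤-Reasoning
      m = p ℕ.* (suc k ℕ.* suc k)

    cross : ∀ k l → √-num k ℕ.* suc l ℕ.≤ suc (√-num l) ℕ.* suc k
    cross k l with √-num k ℕ.* suc l ℕ.≤? suc (√-num l) ℕ.* suc k
    ... | yes h = h
    ... | no ¬h = contradiction chain (ℕ.<-irrefl refl)
      where
      open ℕ.≤-Reasoning
      r = √-num k
      s = suc (√-num l)
      K = suc k
      L = suc l
      chain : (r ℕ.* L) ℕ.* (r ℕ.* L) ℕ.* d ℕ.< (r ℕ.* L) ℕ.* (r ℕ.* L) ℕ.* d
      chain = begin-strict
        (r ℕ.* L) ℕ.* (r ℕ.* L) ℕ.* d ≡⟨ solveℕ 3 (λ r L d → (r :× L) :× (r :× L) :× d :≡ r :× r :× d :× (L :× L)) refl r L d ⟩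
        r ℕ.* r ℕ.* d ℕ.* (L ℕ.* L)   ≤⟨ ℕ.*-monoˡ-≤ (L ℕ.* L) (lower k) ⟩
        p ℕ.* (K ℕ.* K) ℕ.* (L ℕ.* L) ≡⟨ solveℕ 3 (λ p K L → p :× (K :× K) :× (L :× L) :≡ p :× (L :× L) :× (K :× K)) refl p K L ⟩
        p ℕ.* (L ℕ.* L) ℕ.* (K ℕ.* K) <⟨ ℕ.*-monoˡ-< (K ℕ.* K) (upper l) ⟩
        s ℕ.* s ℕ.* d ℕ.* (K ℕ.* K)   ≡⟨ solveℕ 3 (λ s d K → s :× s :× d :× (K :× K) :≡ (s :× K) :× (s :× K) :× d) refl s d K ⟩
        (s ℕ.* K) ℕ.* (s ℕ.* K) ℕ.* d ≤⟨ ℕ.*-monoˡ-≤ d (ℕ.*-mono-≤ s*K≤ s*K≤) ⟩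
        (r ℕ.* L) ℕ.* (r ℕ.* L) ℕ.* d ∎
        where s*K≤ = ℕ.<⇒≤ (ℕ.≰⇒> ¬h)

    one-sided : ∀ {ε} k l → + 1 / suc l ≤ ε → √-seq k ≤ √-seq l + ε
    one-sided {ε} k l h = begin
      √-seq k                       ≤⟨ /-≤ (√-num k) (suc k) (suc (√-num l)) (suc l) (cross k l) ⟩
      + suc (√-num l) / suc l       ≡⟨ cong (λ j → + j / suc l) (ℕ.+-comm 1 (√-num l)) ⟩
      + (√-num l ℕ.+ 1) / suc l     ≡⟨ /-+ (√-num l) 1 (suc l) ⟩
      √-seq l + + 1 / suc l         ≤⟨ +-monoʳ-≤ (√-seq l) h ⟩
      √-seq l + ε                   ∎
      where open ≤-Reasoning

    1/-≤ : ∀ {ε} → 0ℚ < ε → ∀ k → ↧ₙ ε ℕ.≤ k → + 1 / suc k ≤ ε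
    1/-≤ {ε} 0<ε k h = ≤-trans
      (/-≤ 1 (suc k) 1 (↧ₙ ε) (ℕ.*-monoʳ-≤ 1 (ℕ.m≤n⇒m≤1+n h)))
      (archimedean 0<ε)

  open √-Bounds

  √ : .{{NonNegative q}} → ℝ
  √ .seq = √-seq
  √ .cauchy ε 0<ε = ↧ₙ ε , λ k l N≤k N≤l →
    far $ ≤-close (one-sided k l (1/-≤ 0<ε l N≤l)) (one-sided l k (1/-≤ 0<ε k N≤k))

-- nᶻ for an integer z
_^ᶻ_ : (n : ℕ) .{{_ : NonZero n}} → ℤ → ℚ
n ^ᶻ (+ k)    = + (n ℕ.^ k) / 1
n ^ᶻ -[1+ k ] = (+ 1 / (n ℕ.^ suc k)) {{ℕ.m^n≢0 n (suc k)}}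

module PowerSign where
  ^ᶻ-nonNegative : ∀ n .{{_ : NonZero n}} z → NonNegative (n ^ᶻ z)
  ^ᶻ-nonNegative n (+ k)    = normalize-nonNeg (n ℕ.^ k) 1
  ^ᶻ-nonNegative n -[1+ k ] = normalize-nonNeg 1 (n ℕ.^ suc k) {{ℕ.m^n≢0 n (suc k)}}

open PowerSign

-- n raised to the half-integer z/2, namely √(nᶻ).  In particular
-- 1 / n^(a/2 - 1) is n ^[ 2 - a /2].
_^[_/2] : (n : ℕ) .{{_ : NonZero n}} → ℤ → ℝ
n ^[ z /2] = √ (n ^ᶻ z) {{^ᶻ-nonNegative n z}}

------------------------------------------------------------------------
-- Asymptotics over the positive integers.  Rational constants are no
-- restriction: there is a rational between 0 and any positive real, and
-- above any real.

infix 4 _∈Θ_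
_∈Θ_ : (f g : (n : ℕ) .{{_ : NonZero n}} → ℝ) → Set
f ∈Θ g = ∃ λ c₁ → ∃ λ c₂ → ∃ λ n₀ → 0ℚ < c₁ × 0ℚ < c₂ ×
  (∀ n .{{_ : NonZero n}} → n₀ ℕ.≤ n → c₁ ·ᴿ g n ≤ᴿ f n × f n ≤ᴿ c₂ ·ᴿ g n)

------------------------------------------------------------------------
-- Expectation of f(U₁,…,Uₙ), where U₁,…,Uₙ are independent and uniform on
-- [0,1].  This is the integral of f over the unit cube.  A uniformly
-- continuous f is determined by its values at rational points, and its
-- (Riemann) integral is the limit, as N → ∞, of the average of f over the
-- grid {0, 1/N, …, (N-1)/N}ⁿ.

InUnit : ℚ → Set
InUnit x = 0ℚ ≤ x × x ≤ 1ℚ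

UniformlyContinuous : ∀ {n} → (Vec ℚ n → ℚ) → Set
UniformlyContinuous f =
  ∀ ε → 0ℚ < ε → ∃ λ δ → 0ℚ < δ × (∀ u v → All InUnit u → All InUnit v →
    Pointwise (λ x y → ∣ x - y ∣ ≤ δ) u v → ∣ f u - f v ∣ ≤ ε)

mean : (N : ℕ) .{{_ : NonZero N}} → (Fin N → ℚ) → ℚ
mean N x = + 1 / N * sum x

gridMean : (N : ℕ) .{{_ : NonZero N}} → ∀ {n} → (Vec ℚ n → ℚ) → ℚ
gridMean N {zero}  f = f []
gridMean N {suc n} f = mean N λ j → gridMean N {n} λ u → f (+ toℕ j / N ∷ u)

module GridMeans where
  sum-mono : ∀ {N} {x y : Fin N → ℚ} → (∀ j → x j ≤ y j) → sum x ≤ sum y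
  sum-mono {zero}  h = ≤-refl
  sum-mono {suc N} h = +-mono-≤ (h zero) (sum-mono (λ j → h (suc j)))

  sum-const : ∀ N c → sum {N} (λ _ → c) ≡ + N / 1 * c
  sum-const zero    c = sym (*-zeroˡ c)
  sum-const (suc N) c = begin
    c + sum {N} (λ _ → c)        ≡⟨ cong (λ z → c + z) (sum-const N c) ⟩
    c + + N / 1 * c              ≡⟨ solve 2 (λ c x → c :+ x :* c := (con 1ℚ :+ x) :* c) refl c (+ N / 1) ⟩
    (1ℚ + + N / 1) * c           ≡⟨ cong (_* c) (sym (/-+ 1 N 1)) ⟩
    + suc N / 1 * c              ∎
    where open ≡-Reasoning

  sum-++ : ∀ M {K} (x : Fin (M ℕ.+ K) → ℚ) →
           sum x ≡ sum (λ k → x (k Fin.↑ˡ K)) + sum (λ k → x (M Fin.↑ʳ k))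
  sum-++ zero    x = sym (+-identityˡ _)
  sum-++ (suc M) {K} x = trans (cong (λ z → x zero + z) (sum-++ M (λ k → x (suc k))))
    (sym (+-assoc (x zero) (sum (λ k → x (suc (k Fin.↑ˡ K)))) (sum (λ k → x (suc (M Fin.↑ʳ k))))))

  sum-combine : ∀ N M (x : Fin (N ℕ.* M) → ℚ) →
                sum x ≡ sum {N} (λ j → sum {M} (λ k → x (combine j k)))
  sum-combine zero    M x = refl
  sum-combine (suc N) M x = trans (sum-++ M x)
    (cong (λ z → sum (λ k → x (k Fin.↑ˡ (N ℕ.* M))) + z) (sum-combine N M (λ k → x (M Fin.↑ʳ k))))

  1/n*n : ∀ n .{{_ : NonZero n}} → + 1 / n * (+ n / 1) ≡ 1ℚ
  1/n*n (suc n) = toℚᵘ-injective (begin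
    toℚᵘ (+ 1 / suc n * (+ suc n / 1))  ≈⟨ toℚᵘ-homo-* (+ 1 / suc n) (+ suc n / 1) ⟩
    toℚᵘ (+ 1 / suc n) ℚᵘ.* toℚᵘ (+ suc n / 1) ≈⟨ ℚᵘ.*-cong (toℚᵘ-fromℚᵘ (+ 1 ℚᵘ./ suc n)) (toℚᵘ-fromℚᵘ (+ suc n ℚᵘ./ 1)) ⟩
    + 1 ℚᵘ./ suc n ℚᵘ.* (+ suc n ℚᵘ./ 1)  ≈⟨ ℚᵘ.*≡* (trans (ℤ.*-identityʳ (+ 1 ℤ.* + suc n)) (cong (λ m → + 1 ℤ.* + suc m) (sym (ℕ.*-identityʳ n)))) ⟩
    ℚᵘ.1ℚᵘ ∎)
    where open ℚᵘ.≃-Reasoning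

  1/n*1/m : ∀ n m .{{_ : NonZero n}} .{{_ : NonZero m}} →
            (+ 1 / (n ℕ.* m)) {{ℕ.m*n≢0 n m}} ≡ + 1 / n * (+ 1 / m)
  1/n*1/m (suc n) (suc m) = toℚᵘ-injective (begin
    toℚᵘ (+ 1 / (suc n ℕ.* suc m))       ≈⟨ toℚᵘ-fromℚᵘ (+ 1 ℚᵘ./ (suc n ℕ.* suc m)) ⟩
    + 1 ℚᵘ./ suc n ℚᵘ.* (+ 1 ℚᵘ./ suc m) ≈⟨ ℚᵘ.≃-sym (ℚᵘ.*-cong (toℚᵘ-fromℚᵘ (+ 1 ℚᵘ./ suc n)) (toℚᵘ-fromℚᵘ (+ 1 ℚᵘ./ suc m))) ⟩
    toℚᵘ (+ 1 / suc n) ℚᵘ.* toℚᵘ (+ 1 / suc m) ≈⟨ ℚᵘ.≃-sym (toℚᵘ-homo-* (+ 1 / suc n) (+ 1 / suc m)) ⟩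
    toℚᵘ (+ 1 / suc n * (+ 1 / suc m))   ∎)
    where open ℚᵘ.≃-Reasoning

  mean-const : ∀ N .{{_ : NonZero N}} c → mean N (λ _ → c) ≡ c
  mean-const N c = begin
    + 1 / N * sum {N} (λ _ → c)    ≡⟨ cong (λ z → + 1 / N * z) (sum-const N c) ⟩
    + 1 / N * (+ N / 1 * c)        ≡⟨ sym (*-assoc (+ 1 / N) (+ N / 1) c) ⟩
    + 1 / N * (+ N / 1) * c        ≡⟨ cong (_* c) (1/n*n N) ⟩
    1ℚ * c                         ≡⟨ *-identityˡ c ⟩
    c                              ∎
    where open ≡-Reasoning

  mean-combine : ∀ N M .{{_ : NonZero N}} .{{_ : NonZero M}} x →
    mean (N ℕ.* M) {{ℕ.m*n≢0 N M}} x ≡ mean N (λ j → mean M (λ k → x (combine j k)))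
  mean-combine N M x = begin
    (+ 1 / (N ℕ.* M)) {{ℕ.m*n≢0 N M}} * sum x
      ≡⟨ cong₂ _*_ (1/n*1/m N M) (sum-combine N M x) ⟩
    + 1 / N * (+ 1 / M) * sum y
      ≡⟨ *-assoc (+ 1 / N) (+ 1 / M) (sum y) ⟩
    + 1 / N * (+ 1 / M * sum y)
      ≡⟨ cong (λ z → + 1 / N * z) (*-distribˡ-sum (+ 1 / M) y) ⟩
    + 1 / N * sum (λ j → + 1 / M * y j) ∎
    where
    open ≡-Reasoning
    y = λ j → sum {M} (λ k → x (combine {N} j k))

  mean-≤ : ∀ N .{{_ : NonZero N}} {ε} {x y : Fin N → ℚ} →
           (∀ j → x j ≤ y j + ε) → mean N x ≤ mean N y + ε
  mean-≤ N {ε} {x} {y} h = begin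
    mean N x                                ≤⟨ *-monoˡ (0≤/ 1 N) (sum-mono h) ⟩
    + 1 / N * sum (λ j → y j + ε)           ≡⟨ cong (λ z → + 1 / N * z) (∑-distrib-+ y (λ _ → ε)) ⟩
    + 1 / N * (sum y + sum {N} (λ _ → ε))   ≡⟨ *-distribˡ-+ (+ 1 / N) (sum y) (sum {N} (λ _ → ε)) ⟩
    mean N y + mean N (λ _ → ε)             ≡⟨ cong (λ z → mean N y + z) (mean-const N ε) ⟩
    mean N y + ε                            ∎
    where open ≤-Reasoning

  mean-close : ∀ N .{{_ : NonZero N}} {ε} {x y : Fin N → ℚ} →
               (∀ j → Close ε (x j) (y j)) → Close ε (mean N x) (mean N y)
  mean-close N {x = x} {y} h = ≤-close
    (mean-≤ N {x = x} {y} (λ j → close-≤ (h j)))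
    (mean-≤ N {x = y} {x} (λ j → close-≤ (close-sym (h j))))

  grid-inUnit : ∀ N .{{_ : NonZero N}} (j : Fin N) → InUnit (+ toℕ j / N)
  grid-inUnit N j = 0≤/ (toℕ j) N ,
    ≤-trans (/-≤ (toℕ j) N N N (ℕ.*-monoˡ-≤ N (ℕ.<⇒≤ (Fin.toℕ<n j)))) (≤-reflexive (n/n≡1 N))

  grid-close : ∀ N M .{{_ : NonZero N}} .{{_ : NonZero M}} (j : Fin N) (k : Fin M) →
    Close (+ 1 / N) (+ toℕ j / N) ((+ toℕ (combine j k) / (N ℕ.* M)) {{ℕ.m*n≢0 N M}})
  grid-close N M j k = ≤-close
    (≤-trans
      (/-≤ (toℕ j) N (toℕ (combine j k)) (N ℕ.* M) (begin
        toℕ j ℕ.* (N ℕ.* M)             ≡⟨ lemma (toℕ j) ⟩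
        M ℕ.* toℕ j ℕ.* N               ≤⟨ ℕ.*-monoˡ-≤ N (ℕ.m≤m+n (M ℕ.* toℕ j) (toℕ k)) ⟩
        (M ℕ.* toℕ j ℕ.+ toℕ k) ℕ.* N   ≡⟨ cong (ℕ._* N) (sym (Fin.toℕ-combine j k)) ⟩
        toℕ (combine j k) ℕ.* N         ∎))
      (≤-trans (≤-reflexive (sym (+-identityʳ q))) (+-monoʳ-≤ q (0≤/ 1 N))))
    (≤-trans
      (/-≤ (toℕ (combine j k)) (N ℕ.* M) (toℕ j ℕ.+ 1) N (begin
        toℕ (combine j k) ℕ.* N         ≡⟨ cong (ℕ._* N) (Fin.toℕ-combine j k) ⟩
        (M ℕ.* toℕ j ℕ.+ toℕ k) ℕ.* N   ≤⟨ ℕ.*-monoˡ-≤ N (ℕ.+-monoʳ-≤ (M ℕ.* toℕ j) (ℕ.<⇒≤ (Fin.toℕ<n k))) ⟩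
        (M ℕ.* toℕ j ℕ.+ M) ℕ.* N       ≡⟨ cong (ℕ._* N) (trans (cong (M ℕ.* toℕ j ℕ.+_) (sym (ℕ.*-identityʳ M))) (sym (ℕ.*-distribˡ-+ M (toℕ j) 1))) ⟩
        M ℕ.* (toℕ j ℕ.+ 1) ℕ.* N       ≡⟨ sym (lemma (toℕ j ℕ.+ 1)) ⟩
        (toℕ j ℕ.+ 1) ℕ.* (N ℕ.* M)     ∎))
      (≤-reflexive (/-+ (toℕ j) 1 N)))
    where
    open ℕ.≤-Reasoning
    instance _ = ℕ.m*n≢0 N M
    q = + toℕ (combine j k) / (N ℕ.* M)
    lemma : ∀ i → i ℕ.* (N ℕ.* M) ≡ M ℕ.* i ℕ.* N
    lemma i = trans (cong (i ℕ.*_) (ℕ.*-comm N M))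
      (trans (sym (ℕ.*-assoc i M N)) (cong (ℕ._* N) (ℕ.*-comm i M)))

  gridMean-refine : ∀ N M .{{_ : NonZero N}} .{{_ : NonZero M}} {ε n} (f g : Vec ℚ n → ℚ) →
    (∀ u v → All InUnit u → All InUnit v → Pointwise (Close (+ 1 / N)) u v → Close ε (f u) (g v)) →
    Close ε (gridMean N f) (gridMean (N ℕ.* M) {{ℕ.m*n≢0 N M}} g)
  gridMean-refine N M {n = zero}  f g h = h [] [] [] [] []
  gridMean-refine N M {ε} {suc n} f g h =
    subst (Close ε (gridMean N f)) (sym (mean-combine N M B))
      (mean-close N λ j → subst (λ z → Close ε z _) (mean-const M _)
        (mean-close M λ k → gridMean-refine N M _ _ λ u v u∈ v∈ uv →
          h _ _ (grid-inUnit N j ∷ u∈) (grid-inUnit (N ℕ.* M) (combine j k) ∷ v∈)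
            (grid-close N M j k ∷ uv)))
    where
    instance _ = ℕ.m*n≢0 N M
    B = λ i → gridMean (N ℕ.* M) (λ u → g (+ toℕ i / (N ℕ.* M) ∷ u))

  gridMean-cong : ∀ {N N′} .{{_ : NonZero N}} .{{_ : NonZero N′}} → N ≡ N′ →
                  ∀ {n} (f : Vec ℚ n → ℚ) → gridMean N f ≡ gridMean N′ f
  gridMean-cong refl f = refl

open GridMeans

E : ∀ {n} (f : Vec ℚ n → ℚ) → UniformlyContinuous f → ℝ
E f f-cont .seq k = gridMean (suc k) f
E f f-cont .cauchy ε 0<ε =
  let δ , 0<δ , h = f-cont (½ * ε) (0<* 0<½ 0<ε)
      fine : ∀ k → ↧ₙ δ ℕ.≤ k → + 1 / suc k ≤ δ
      fine k N≤k = ≤-trans (/-≤ 1 (suc k) 1 (↧ₙ δ) (ℕ.*-monoʳ-≤ 1 (ℕ.m≤n⇒m≤1+n N≤k)))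
                           (archimedean 0<δ)
      refine : ∀ k l → ↧ₙ δ ℕ.≤ k →
               Close (½ * ε) (gridMean (suc k) f) (gridMean (suc k ℕ.* suc l) f)
      refine k l N≤k = gridMean-refine (suc k) (suc l) f f λ u v u∈ v∈ uv →
        close (h u v u∈ v∈ (Pointwise.map (λ c → ≤-trans (far c) (fine k N≤k)) uv))
  in ↧ₙ δ , λ k l N≤k N≤l →
    far $ subst (λ z → Close z (gridMean (suc k) f) (gridMean (suc l) f)) (halves ε)
      (close-trans (refine k l N≤k)
        (close-sym (subst (Close _ _) (gridMean-cong (ℕ.*-comm (suc l) (suc k)) f) (refine l k N≤l))))

------------------------------------------------------------------------
-- Order statistics and anchors.  Index i : Fin n is the sensor numbered
-- toℕ i + 1.

-- X i u is the i-th smallest coordinate of u.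
X : ∀ {n} → Fin n → Vec ℚ n → ℚ
X i u = List.lookup (sort (toList u)) (Fin.cast (sym length-sort) i)
  where
  length-sort : List.length (sort (toList u)) ≡ _
  length-sort = trans (↭-length (sort-↭ (toList u))) (Vec.length-toList u)

t : (n : ℕ) .{{_ : NonZero n}} → Fin n → ℚ
t n i = + suc (toℕ i) / n - (+ 1 / (2 ℕ.* n)) {{ℕ.m*n≢0 2 n}}

module Lipschitz where

  -- Insertion sort by min/max, through which X is seen to be 1-Lipschitz.
  insert : ∀ {n} → ℚ → Vec ℚ n → Vec ℚ (suc n)
  insert x []       = x ∷ []
  insert x (y ∷ ys) = x ⊓ y ∷ insert (x ⊔ y) ys

  isort : ∀ {n} → Vec ℚ n → Vec ℚ n
  isort []       = []
  isort (x ∷ xs) = insert x (isort xs)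

  insert-↭ : ∀ {n} x (ys : Vec ℚ n) → toList (insert x ys) ↭ x ∷ toList ys
  insert-↭ x []       = ↭-refl
  insert-↭ x (y ∷ ys) with ≤-total x y
  ... | inj₁ x≤y rewrite p≤q⇒p⊓q≡p x≤y | p≤q⇒p⊔q≡q x≤y = prep x (insert-↭ y ys)
  ... | inj₂ y≤x rewrite p≥q⇒p⊓q≡q y≤x | p≥q⇒p⊔q≡p y≤x =
    ↭-trans (prep y (insert-↭ x ys)) (swap y x ↭-refl)

  isort-↭ : ∀ {n} (u : Vec ℚ n) → toList (isort u) ↭ toList u
  isort-↭ []       = ↭-refl
  isort-↭ (x ∷ xs) = ↭-trans (insert-↭ x (isort xs)) (prep x (isort-↭ xs))

  insert-↗′ : ∀ {n} z x (ys : Vec ℚ n) → z ≤ x →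
              Sorted (z ∷ toList ys) → Sorted (z ∷ toList (insert x ys))
  insert-↗′ z x []       z≤x _           = z≤x ∷ [-]
  insert-↗′ z x (y ∷ ys) z≤x (z≤y ∷ ys↗) =
    ⊓-glb z≤x z≤y ∷ insert-↗′ (x ⊓ y) (x ⊔ y) ys (≤-trans (p⊓q≤p x y) (p≤p⊔q x y)) (lower-head ys ys↗)
    where
    lower-head : ∀ {n} (ys : Vec ℚ n) → Sorted (y ∷ toList ys) → Sorted (x ⊓ y ∷ toList ys)
    lower-head []      _        = [-]
    lower-head (_ ∷ _) (h ∷ hs) = ≤-trans (p⊓q≤q x y) h ∷ hs

  insert-↗ : ∀ {n} x (ys : Vec ℚ n) → Sorted (toList ys) → Sorted (toList (insert x ys))
  insert-↗ x []       _   = [-]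
  insert-↗ x (y ∷ ys) ys↗ =
    Linked.tail (insert-↗′ (x ⊓ y) x (y ∷ ys) (p⊓q≤p x y) (p⊓q≤q x y ∷ ys↗))

  isort-↗ : ∀ {n} (u : Vec ℚ n) → Sorted (toList (isort u))
  isort-↗ []       = []
  isort-↗ (x ∷ xs) = insert-↗ x (isort xs) (isort-↗ xs)

  sort≡isort : ∀ {n} (u : Vec ℚ n) → sort (toList u) ≡ toList (isort u)
  sort≡isort u = ListPointwise.Pointwise-≡⇒≡
    (↗↭↗⇒≋ (DecTotalOrder.totalOrder ≤-decTotalOrder) (sort-↗ (toList u)) (isort-↗ u)
      (↭⇒↭ₛ (↭-trans (sort-↭ (toList u)) (↭-sym (isort-↭ u)))))

  lookup-cast : ∀ {n} (v : Vec ℚ n) {xs} → xs ≡ toList v →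
                .(eq : n ≡ List.length xs) (i : Fin n) →
                List.lookup xs (Fin.cast eq i) ≡ Vec.lookup v i
  lookup-cast (x ∷ v) refl eq zero    = refl
  lookup-cast (x ∷ v) refl eq (suc i) = lookup-cast v refl (ℕ.suc-injective eq) i

  X≡isort : ∀ {n} (i : Fin n) u → X i u ≡ Vec.lookup (isort u) i
  X≡isort i u = lookup-cast (isort u) (sort≡isort u) _ i

  insert-all : ∀ {n x} {ys : Vec ℚ n} → InUnit x → All InUnit ys → All InUnit (insert x ys)
  insert-all x∈ [] = x∈ ∷ []
  insert-all {x = x} {y ∷ _} x∈ (y∈ ∷ ys∈) with ≤-total x y
  ... | inj₁ x≤y rewrite p≤q⇒p⊓q≡p x≤y | p≤q⇒p⊔q≡q x≤y = x∈ ∷ insert-all y∈ ys∈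
  ... | inj₂ y≤x rewrite p≥q⇒p⊓q≡q y≤x | p≥q⇒p⊔q≡p y≤x = y∈ ∷ insert-all x∈ ys∈

  isort-all : ∀ {n} {u : Vec ℚ n} → All InUnit u → All InUnit (isort u)
  isort-all []         = []
  isort-all (x∈ ∷ xs∈) = insert-all x∈ (isort-all xs∈)

  _≲[_]_ : ∀ {n} → Vec ℚ n → ℚ → Vec ℚ n → Set
  u ≲[ δ ] v = Pointwise (λ x y → x ≤ y + δ) u v

  insert-≲ : ∀ {n δ x x′} {ys ys′ : Vec ℚ n} →
             x ≤ x′ + δ → ys ≲[ δ ] ys′ → insert x ys ≲[ δ ] insert x′ ys′
  insert-≲ hx [] = hx ∷ []
  insert-≲ {δ = δ} {x} {x′} {y ∷ _} {y′ ∷ _} hx (hy ∷ hys) =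
    ≤-trans (⊓-mono-≤ hx hy) (≤-reflexive (sym (mono-≤-distrib-⊓ (+-monoˡ-≤ δ) x′ y′))) ∷
    insert-≲ (≤-trans (⊔-mono-≤ hx hy) (≤-reflexive (sym (mono-≤-distrib-⊔ (+-monoˡ-≤ δ) x′ y′)))) hys

  isort-≲ : ∀ {n δ} {u v : Vec ℚ n} → u ≲[ δ ] v → isort u ≲[ δ ] isort v
  isort-≲ []       = []
  isort-≲ (h ∷ hs) = insert-≲ h (isort-≲ hs)

  X-≤ : ∀ {n δ} (i : Fin n) {u v : Vec ℚ n} → u ≲[ δ ] v → X i u ≤ X i v + δ
  X-≤ {δ = δ} i {u} {v} h = subst₂ (λ x y → x ≤ y + δ) (sym (X≡isort i u)) (sym (X≡isort i v))
    (Pointwise.lookup (isort-≲ h) i)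

  X-close : ∀ {n δ} (i : Fin n) {u v : Vec ℚ n} →
            Pointwise (Close δ) u v → Close δ (X i u) (X i v)
  X-close i h = ≤-close
    (X-≤ i (Pointwise.map close-≤ h))
    (X-≤ i (Pointwise.map close-≤ (Pointwise.sym close-sym h)))

  ∣X∣≤1 : ∀ {n} (i : Fin n) {u : Vec ℚ n} → All InUnit u → ∣ X i u ∣ ≤ 1ℚ
  ∣X∣≤1 i {u} u∈ =
    let 0≤x , x≤1 = All.lookup⁺ (isort-all u∈) i
    in subst (λ x → ∣ x ∣ ≤ 1ℚ) (sym (X≡isort i u)) (≤-trans (≤-reflexive (0≤p⇒∣p∣≡p 0≤x)) x≤1)

  0≤^ : ∀ {x} → 0ℚ ≤ x → ∀ k → 0ℚ ≤ x ^ k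
  0≤^ 0≤x zero    = <⇒≤ (positive⁻¹ 1ℚ)
  0≤^ 0≤x (suc k) = 0≤* 0≤x (0≤^ 0≤x k)

  ^-mono : ∀ {x B} → 0ℚ ≤ x → x ≤ B → ∀ k → x ^ k ≤ B ^ k
  ^-mono 0≤x x≤B zero    = ≤-refl
  ^-mono 0≤x x≤B (suc k) = ≤-trans (*-monoʳ (0≤^ 0≤x k) x≤B)
    (*-monoˡ (≤-trans 0≤x x≤B) (^-mono 0≤x x≤B k))

  lip : ℚ → ℕ → ℚ
  lip B zero    = 0ℚ
  lip B (suc k) = B ^ k + B * lip B k

  0≤lip : ∀ {B} → 0ℚ ≤ B → ∀ k → 0ℚ ≤ lip B k
  0≤lip 0≤B zero    = ≤-refl
  0≤lip 0≤B (suc k) = 0≤+ (0≤^ 0≤B k) (0≤* 0≤B (0≤lip 0≤B k))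

  ^-lip : ∀ {B d x y} → 0ℚ ≤ d → 0ℚ ≤ x → x ≤ B → 0ℚ ≤ y → y ≤ B → x ≤ y + d →
          ∀ k → x ^ k ≤ y ^ k + lip B k * d
  ^-lip {d = d} _ _ _ _ _ _ zero = ≤-reflexive (sym (trans (cong (λ z → 1ℚ + z) (*-zeroˡ d)) (+-identityʳ 1ℚ)))
  ^-lip {B} {d} {x} {y} 0≤d 0≤x x≤B 0≤y y≤B x≤y+d (suc k) = begin
    x * x ^ k                               ≤⟨ *-monoˡ 0≤x (^-lip 0≤d 0≤x x≤B 0≤y y≤B x≤y+d k) ⟩
    x * (y ^ k + L * d)                     ≡⟨ *-distribˡ-+ x (y ^ k) (L * d) ⟩
    x * y ^ k + x * (L * d)                 ≤⟨ +-mono-≤ (*-monoʳ (0≤^ 0≤y k) x≤y+d)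
                                                        (*-monoʳ (0≤* (0≤lip 0≤B k) 0≤d) x≤B) ⟩
    (y + d) * y ^ k + B * (L * d)           ≡⟨ cong (λ z → z + B * (L * d)) (*-distribʳ-+ (y ^ k) y d) ⟩
    y * y ^ k + d * y ^ k + B * (L * d)     ≤⟨ +-monoˡ-≤ (B * (L * d)) (+-monoʳ-≤ (y * y ^ k) (*-monoˡ 0≤d (^-mono 0≤y y≤B k))) ⟩
    y * y ^ k + d * B ^ k + B * (L * d)     ≡⟨ solve 5 (λ a d b B L → a :+ d :* b :+ B :* (L :* d) := a :+ (b :+ B :* L) :* d) refl (y * y ^ k) d (B ^ k) B L ⟩
    y * y ^ k + (B ^ k + B * L) * d         ∎
    where
    open ≤-Reasoning
    L = lip B k
    0≤B = ≤-trans 0≤x x≤B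

open Lipschitz

displacement-continuous : ∀ (a : ℕ) {n} .{{_ : NonZero n}} (i : Fin n) →
  UniformlyContinuous (λ u → ∣ X i u - t n i ∣ ^ a)
displacement-continuous a {n} i ε 0<ε =
  let δ , 0<δ , Lδ≤ε = divide L ε (0≤lip 0≤B a) 0<ε
  in δ , 0<δ , λ u v u∈ v∈ uv →
    let Xu~Xv = X-close i (Pointwise.map close uv) in far $ ≤-close
      (≤-trans (bound (<⇒≤ 0<δ) u∈ v∈ Xu~Xv) (+-monoʳ-≤ (∣ X i v - c ∣ ^ a) Lδ≤ε))
      (≤-trans (bound (<⇒≤ 0<δ) v∈ u∈ (close-sym Xu~Xv)) (+-monoʳ-≤ (∣ X i u - c ∣ ^ a) Lδ≤ε))
  where
  open ≤-Reasoning
  c = t n i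
  B = 1ℚ + ∣ c ∣
  L = lip B a
  0≤B = 0≤+ (<⇒≤ (positive⁻¹ 1ℚ)) (0≤∣p∣ c)

  ∣X-c∣≤B : ∀ {u} → All InUnit u → ∣ X i u - c ∣ ≤ B
  ∣X-c∣≤B {u} u∈ = ≤-trans (∣p-q∣≤∣p∣+∣q∣ (X i u) c) (+-monoˡ-≤ ∣ c ∣ (∣X∣≤1 i u∈))

  shift : ∀ {δ x y} → Close δ x y → ∣ x - c ∣ ≤ ∣ y - c ∣ + δ
  shift {δ} {x} {y} (close h) = begin
    ∣ x - c ∣               ≡⟨ cong ∣_∣ (solve 3 (λ x y c → x :- c := (y :- c) :+ (x :- y)) refl x y c) ⟩
    ∣ (y - c) + (x - y) ∣   ≤⟨ ∣p+q∣≤∣p∣+∣q∣ (y - c) (x - y) ⟩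
    ∣ y - c ∣ + ∣ x - y ∣   ≤⟨ +-monoʳ-≤ ∣ y - c ∣ h ⟩
    ∣ y - c ∣ + δ           ∎

  bound : ∀ {δ u v} → 0ℚ ≤ δ → All InUnit u → All InUnit v → Close δ (X i u) (X i v) →
          ∣ X i u - c ∣ ^ a ≤ ∣ X i v - c ∣ ^ a + L * δ
  bound {u = u} {v} 0≤δ u∈ v∈ h =
    ^-lip 0≤δ (0≤∣p∣ (X i u - c)) (∣X-c∣≤B u∈) (0≤∣p∣ (X i v - c)) (∣X-c∣≤B v∈) (shift h) a

{-# OPTIONS --safe #-}

-- Let u₁, …, uₙ be the unsorted positions.  All expectations are averages over
-- the grid {0, 1/N, …, (N-1)/N}ⁿ with N ≥ n, bounded uniformly in N.
--
-- Upper bound: n tᵢ lies between #{j : uⱼ < Xᵢ} and #{j : uⱼ ≤ Xᵢ}, so the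
-- even power (a+1) of n (tᵢ - Xᵢ) is controlled by sums of the form
-- ∑ⱼ (1[uⱼ < x] - x) at x = Xᵢ.  Summing over i, the Xᵢ may be replaced by the
-- uᵢ, and conditionally on uᵢ = x this is a sum of independent centred bounded
-- variables, whose moment of order 2m is O(nᵐ).  Finally
-- √n |y|ᵃ ≤ (√n)ᵃ⁺¹ + |y|ᵃ⁺¹ for y = n (tᵢ - Xᵢ).
--
-- Lower bound: sorting preserves sums, so ∑ᵢ |Xᵢ - tᵢ| ≥ |∑ⱼ (uⱼ - 1/2)|, and
-- the right-hand side has expectation of order √n because its second moment is
-- of order n and its fourth is O(n²).  The inequality hᵃ⁻¹|y| ≤ |y|ᵃ + hᵃ, for
-- y = n (tᵢ - Xᵢ) and h of order √n, then passes to the power a.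
module Submission where

open import Defs
open import Algebra.Bundles using (CommutativeRing)
open import Data.Bool.Base using (if_then_else_)
open import Data.Fin.Base using (Fin; zero; suc; toℕ)
import Data.Fin.Properties as Fin
open import Data.Integer.Base as ℤ using (+_; -[1+_])
open import Data.List.Base as List using (List; []; _∷_)
open import Data.List.Relation.Binary.Permutation.Propositional as ↭ using (_↭_)
open import Data.List.Relation.Unary.Linked as Linked using (_∷_)
open import Data.Nat.Base as ℕ using (ℕ; zero; suc; NonZero; s≤s; z≤n)
open import Data.Nat.Divisibility using (_∤_; divides; ∣m∣n⇒∣m+n)
import Data.Nat.Properties as ℕ
open import Data.Product.Base using (∃; _,_)
open import Data.Rational.Base as ℚ hiding (NonZero)
open import Data.Rational.Properties
open import Data.Rational.Solver using (module +-*-Solver)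
open import Data.Sum.Base using (inj₁; inj₂)
open import Data.Vec.Base using (Vec; []; _∷_; toList; lookup; insertAt)
open import Data.Vec.Properties using (insertAt-lookup)
open import Function.Base using (id)
open import Function.Bundles using (mk⇔; _⇔_)
open import Relation.Binary.Bundles using (DecTotalOrder)
open import Relation.Binary.PropositionalEquality
open import Relation.Nullary using (¬_; Dec; yes; no; does; contradiction)
open import Relation.Nullary.Decidable using (does-⇔)

open import Algebra.Properties.CommutativeSemiring.Exp
  (CommutativeRing.commutativeSemiring +-*-commutativeRing)
  using (^-homo-*; ^-distrib-*)
open import Algebra.Properties.Semiring.Sum
  (CommutativeRing.semiring +-*-commutativeRing)
  using (sum; sum-cong-≗; ∑-comm; ∑-distrib-+; *-distribˡ-sum)
open import Data.List.Relation.Unary.Sorted.TotalOrder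
  (DecTotalOrder.totalOrder ≤-decTotalOrder) using (Sorted)
open +-*-Solver using (solve; _:=_; _:+_; _:*_; _:-_; con)
open Arithmetic
open Division using (divide)
open GridMeans using (1/n*n; 1/n*1/m; sum-mono; sum-const; mean-const)
open Isqrt
open Lipschitz using (0≤^; ^-mono; isort; isort-↭; isort-↗; X≡isort)

-- All estimates are between rationals, with r = ⌊√n⌋ in place of √n. Since r² ≤ n ≤ (2r)², each
-- exchange costs a constant depending at most on a, and the half-integer power of n is compared
-- with `scale` only at the end. A grid in place of the cube has three defects: coordinates can
-- coincide, their mean is 1/2 - 1/(2N) instead of 1/2, and 1[uⱼ ≤ x] has mean x + 1/N at a grid
-- point x. Each of the n coordinates contributes an error of order 1/N, so N ≥ n keeps the total at
-- most 1. The moment estimate therefore carries a constant offset z with z² ≤ 4, which takes up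
-- this error together with the fixed term of the coordinate that is conditioned on. Because the
-- constants do not involve N, the inequalities hold term by term, from k = n on, in the sequences
-- that represent the real numbers, and no limit has to be evaluated.

-- Inequalities in the ordered field of rationals

0≤1 : 0ℚ ≤ 1ℚ
0≤1 = <⇒≤ (positive⁻¹ 1ℚ)

0<1 : 0ℚ < 1ℚ
0<1 = positive⁻¹ 1ℚ

-- The slack d is usually an explicit sum of products of nonnegative terms,
-- so that the equation is left to the ring solver.
≤-slack : ∀ {p q d} → 0ℚ ≤ d → q ≡ p + d → p ≤ q
≤-slack {p} {d = d} 0≤d q≡p+d =
  ≤-trans (≤-reflexive (sym (+-identityʳ p)))
    (≤-trans (+-monoʳ-≤ p 0≤d) (≤-reflexive (sym q≡p+d)))

≤⇒0≤- : ∀ {p q} → p ≤ q → 0ℚ ≤ q - p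
≤⇒0≤- {p} {q} p≤q = ≤-trans (≤-reflexive (sym (+-inverseʳ p))) (+-monoˡ-≤ (- p) p≤q)

*-mono : ∀ {p q r s} → 0ℚ ≤ p → p ≤ q → 0ℚ ≤ r → r ≤ s → p * r ≤ q * s
*-mono 0≤p p≤q 0≤r r≤s = ≤-trans (*-monoʳ 0≤r p≤q) (*-monoˡ (≤-trans 0≤p p≤q) r≤s)

*-cancel : ∀ {r p q} → 0ℚ < r → r * p ≤ r * q → p ≤ q
*-cancel {r} 0<r = *-cancelˡ-≤-pos r {{positive 0<r}}

0≤p² : ∀ p → 0ℚ ≤ p * p
0≤p² p with ≤-total 0ℚ p
... | inj₁ 0≤p = 0≤* 0≤p 0≤p
... | inj₂ p≤0 = ≤-trans (0≤* 0≤-p 0≤-p) (≤-reflexive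
    (solve 1 (λ p → (con 0ℚ :- p) :* (con 0ℚ :- p) := p :* p) refl p))
  where 0≤-p = ≤⇒0≤- p≤0

∣p∣²≡p² : ∀ p → ∣ p ∣ * ∣ p ∣ ≡ p * p
∣p∣²≡p² p = trans (sym (∣p*q∣≡∣p∣*∣q∣ p p)) (0≤p⇒∣p∣≡p (0≤p² p))

²-cancel-≤ : ∀ {x y} → 0ℚ ≤ y → x * x ≤ y * y → x ≤ y
²-cancel-≤ {x} {y} 0≤y x²≤y² with x ≤? y
... | yes x≤y = x≤y
... | no  x≰y = contradiction (begin-strict
    y * y   ≤⟨ *-monoˡ 0≤y (<⇒≤ y<x) ⟩
    y * x   <⟨ *-monoˡ-<-pos x {{positive (≤-<-trans 0≤y y<x)}} y<x ⟩
    x * x   ≤⟨ x²≤y² ⟩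
    y * y   ∎) (<-irrefl refl)
  where
  open ≤-Reasoning
  y<x = ≰⇒> x≰y

0<^ : ∀ {x} → 0ℚ < x → ∀ k → 0ℚ < x ^ k
0<^ 0<x zero    = 0<1
0<^ 0<x (suc k) = 0<* 0<x (0<^ 0<x k)

1^ : ∀ k → 1ℚ ^ k ≡ 1ℚ
1^ zero    = refl
1^ (suc k) = trans (*-identityˡ (1ℚ ^ k)) (1^ k)

-- Natural numbers and their integer powers as rationals

ι : ℕ → ℚ
ι n = + n / 1

ι-+ : ∀ m n → ι (m ℕ.+ n) ≡ ι m + ι n
ι-+ m n = /-+ m n 1

ι-suc : ∀ n → ι (suc n) ≡ 1ℚ + ι n
ι-suc n = ι-+ 1 n

ι-* : ∀ m n → ι (m ℕ.* n) ≡ ι m * ι n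
ι-* zero    n = sym (*-zeroˡ (ι n))
ι-* (suc m) n = begin
  ι (n ℕ.+ m ℕ.* n)   ≡⟨ ι-+ n (m ℕ.* n) ⟩
  ι n + ι (m ℕ.* n)   ≡⟨ cong (λ z → ι n + z) (ι-* m n) ⟩
  ι n + ι m * ι n     ≡⟨ solve 2 (λ m n → n :+ m :* n := (con 1ℚ :+ m) :* n) refl (ι m) (ι n) ⟩
  (1ℚ + ι m) * ι n    ≡⟨ cong (λ z → z * ι n) (sym (ι-suc m)) ⟩
  ι (suc m) * ι n     ∎
  where open ≡-Reasoning

ι-^ : ∀ m k → ι (m ℕ.^ k) ≡ ι m ^ k
ι-^ m zero    = refl
ι-^ m (suc k) = trans (ι-* m (m ℕ.^ k)) (cong (λ z → ι m * z) (ι-^ m k))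

ι-mono : ∀ {m n} → m ℕ.≤ n → ι m ≤ ι n
ι-mono {m} {n} m≤n = /-≤ m 1 n 1 (ℕ.*-monoˡ-≤ 1 m≤n)

0≤ι : ∀ n → 0ℚ ≤ ι n
0≤ι n = 0≤/ n 1

1≤ι : ∀ n .{{_ : NonZero n}} → 1ℚ ≤ ι n
1≤ι (suc n) = ι-mono {1} {suc n} (s≤s z≤n)

0<ι : ∀ n .{{_ : NonZero n}} → 0ℚ < ι n
0<ι n = <-≤-trans 0<1 (1≤ι n)

/≡1/* : ∀ m n .{{_ : NonZero n}} → + m / n ≡ + 1 / n * ι m
/≡1/* zero    n = trans (0/n≡0 n) (sym (*-zeroʳ (+ 1 / n)))
/≡1/* (suc m) n = begin
  + suc m / n              ≡⟨ /-+ 1 m n ⟩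
  + 1 / n + + m / n        ≡⟨ cong (λ z → + 1 / n + z) (/≡1/* m n) ⟩
  + 1 / n + + 1 / n * ι m  ≡⟨ solve 2 (λ e m → e :+ e :* m := e :* (con 1ℚ :+ m)) refl (+ 1 / n) (ι m) ⟩
  + 1 / n * (1ℚ + ι m)     ≡⟨ cong (λ z → + 1 / n * z) (sym (ι-suc m)) ⟩
  + 1 / n * ι (suc m)      ∎
  where open ≡-Reasoning

ι*/ : ∀ m n .{{_ : NonZero n}} → ι n * (+ m / n) ≡ ι m
ι*/ m n = begin
  ι n * (+ m / n)          ≡⟨ cong (λ z → ι n * z) (/≡1/* m n) ⟩
  ι n * (+ 1 / n * ι m)    ≡⟨ solve 3 (λ n e m → n :* (e :* m) := e :* n :* m) refl (ι n) (+ 1 / n) (ι m) ⟩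
  + 1 / n * ι n * ι m      ≡⟨ cong (λ z → z * ι m) (1/n*n n) ⟩
  1ℚ * ι m                 ≡⟨ *-identityˡ (ι m) ⟩
  ι m                      ∎
  where open ≡-Reasoning

-- Multiplying by nᵃ gives one formula for both branches of `_^ᶻ_`. The cases are those in which
-- `+ 2 ℤ.- + a` reduces to a constructor: exponents 2, 1, 0, and `-[1+ b ]` for a = b + 3.
n^a*n^ᶻ : ∀ n .{{_ : NonZero n}} a → ι n ^ a * (n ^ᶻ (+ 2 ℤ.- + a)) ≡ ι n * ι n
n^a*n^ᶻ n 0 = trans (*-identityˡ _) (trans (ι-^ n 2) (cong (λ z → ι n * z) (*-identityʳ (ι n))))
n^a*n^ᶻ n 1 = cong₂ _*_ (*-identityʳ (ι n)) (trans (ι-^ n 1) (*-identityʳ (ι n)))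
n^a*n^ᶻ n 2 = trans (*-identityʳ _) (cong (λ z → ι n * z) (*-identityʳ (ι n)))
n^a*n^ᶻ n (suc (suc (suc b))) = begin
  ι n * (ι n * ι n ^ suc b) * x   ≡⟨ solve 3 (λ n p x → n :* (n :* p) :* x := n :* n :* (p :* x)) refl (ι n) (ι n ^ suc b) x ⟩
  ι n * ι n * (ι n ^ suc b * x)   ≡⟨ cong (λ z → ι n * ι n * z) (trans (cong (λ z → z * x) (sym (ι-^ n (suc b)))) (ι*/ 1 (n ℕ.^ suc b))) ⟩
  ι n * ι n * 1ℚ                  ≡⟨ *-identityʳ _ ⟩
  ι n * ι n                       ∎
  where
  open ≡-Reasoning
  instance _ = ℕ.m^n≢0 n (suc b)
  x = + 1 / (n ℕ.^ suc b)

-- Rational approximations of square roots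

module _ (q : ℚ) (0≤q : 0ℚ ≤ q) (k : ℕ) where
  private
    K = ι (suc k)
    s = √-num q k
    p = ℤ.∣ ↥ q ∣
    d = ↧ₙ q
    open √-Bounds q using (lower; upper)

    d*q≡p : ι d * q ≡ ι p
    d*q≡p = trans (cong (λ z → ι d * z) (trans (sym (↥p/↧p≡p q)) (cong (λ z → z / d) (sym (num q 0≤q))))) (ι*/ p d)
      where
      num : ∀ q → 0ℚ ≤ q → + ℤ.∣ ↥ q ∣ ≡ ↥ q
      num (mkℚ (+ n) _ _)     _   = refl
      num (mkℚ -[1+ n ] _ _) 0≤q with nonNegative 0≤q
      ... | ()

    K*√ : K * √-seq q k ≡ ι s
    K*√ = ι*/ s (suc k)

    pK² : ι (p ℕ.* (suc k ℕ.* suc k)) ≡ ι d * (q * (K * K))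
    pK² = begin
      ι (p ℕ.* (suc k ℕ.* suc k)) ≡⟨ ι-* p (suc k ℕ.* suc k) ⟩
      ι p * ι (suc k ℕ.* suc k)   ≡⟨ cong₂ _*_ (sym d*q≡p) (ι-* (suc k) (suc k)) ⟩
      ι d * q * (K * K)           ≡⟨ *-assoc (ι d) q (K * K) ⟩
      ι d * (q * (K * K))         ∎
      where open ≡-Reasoning

    sd : ∀ s → ι (s ℕ.* s ℕ.* d) ≡ ι d * (ι s * ι s)
    sd s = trans (ι-* (s ℕ.* s) d) (trans (cong (λ z → z * ι d) (ι-* s s)) (*-comm (ι s * ι s) (ι d)))

    cancelK² : ∀ {x y} → (K * x) * (K * x) ≤ y * (K * K) → x * x ≤ y
    cancelK² {x} {y} h = *-cancel (0<* (0<ι (suc k)) (0<ι (suc k))) (begin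
      (K * K) * (x * x) ≡⟨ solve 2 (λ K x → (K :* K) :* (x :* x) := (K :* x) :* (K :* x)) refl K x ⟩
      (K * x) * (K * x) ≤⟨ h ⟩
      y * (K * K)       ≡⟨ *-comm y (K * K) ⟩
      (K * K) * y       ∎)
      where open ≤-Reasoning

    cancelK²′ : ∀ {x y} → y * (K * K) ≤ (K * x) * (K * x) → y ≤ x * x
    cancelK²′ {x} {y} h = *-cancel (0<* (0<ι (suc k)) (0<ι (suc k))) (begin
      (K * K) * y       ≡⟨ *-comm (K * K) y ⟩
      y * (K * K)       ≤⟨ h ⟩
      (K * x) * (K * x) ≡⟨ solve 2 (λ K x → (K :* x) :* (K :* x) := (K :* K) :* (x :* x)) refl K x ⟩
      (K * K) * (x * x) ∎)
      where open ≤-Reasoning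

  -- With q = p/d and K = k + 1, `√-seq q k` is s/K for the integer s rounded down from K√q; the
  -- bound s²d ≤ pK² is divided by dK².
  √-seq²≤ : √-seq q k * √-seq q k ≤ q
  √-seq²≤ = cancelK² (subst (_≤ q * (K * K)) (cong₂ _*_ (sym K*√) (sym K*√))
    (*-cancel (0<ι d) (subst₂ _≤_ (sd s) pK² (ι-mono (lower k)))))

  -- One more step of size 1/K passes √q, from pK² < (s+1)²d.
  ≤√-seq² : q ≤ (√-seq q k + + 1 / suc k) * (√-seq q k + + 1 / suc k)
  ≤√-seq² = cancelK²′ (subst (q * (K * K) ≤_) (cong₂ _*_ eq eq)
    (*-cancel (0<ι d) (subst₂ _≤_ pK² (sd (suc s)) (ι-mono (ℕ.<⇒≤ (upper k))))))
    where
    eq : ι (suc s) ≡ K * (√-seq q k + + 1 / suc k)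
    eq = begin
      ι (suc s)                             ≡⟨ ι-suc s ⟩
      ι 1 + ι s                             ≡⟨ cong₂ _+_ (sym (ι*/ 1 (suc k))) (sym K*√) ⟩
      K * (+ 1 / suc k) + K * √-seq q k     ≡⟨ solve 3 (λ K e x → K :* e :+ K :* x := K :* (x :+ e)) refl K (+ 1 / suc k) (√-seq q k) ⟩
      K * (√-seq q k + + 1 / suc k)         ∎
      where open ≡-Reasoning

isqrt²≤ : ∀ n → ι (isqrt n) * ι (isqrt n) ≤ ι n
isqrt²≤ n = subst (_≤ ι n) (ι-* (isqrt n) (isqrt n)) (ι-mono (isqrt-≤ n))

isqrt-nonZero : ∀ n .{{_ : NonZero n}} → NonZero (isqrt n)
isqrt-nonZero (suc n) with isqrt (suc n) | isqrt-> (suc n)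
... | zero  | s≤s ()
... | suc r | _      = _

-- The factor 2 absorbs the rounding: n < (r+1)², and r ≥ 1 gives r + 1 ≤ 2r.
≤[2isqrt]² : ∀ n .{{_ : NonZero n}} → ι n ≤ (ι 2 * ι (isqrt n)) * (ι 2 * ι (isqrt n))
≤[2isqrt]² n = begin
  ι n                                           ≤⟨ ι-mono (ℕ.<⇒≤ (isqrt-> n)) ⟩
  ι (suc r ℕ.* suc r)                           ≡⟨ ι-* (suc r) (suc r) ⟩
  ι (suc r) * ι (suc r)                         ≤⟨ *-mono (0≤ι (suc r)) h (0≤ι (suc r)) h ⟩
  (ι 2 * ι r) * (ι 2 * ι r)                     ∎
  where
  open ≤-Reasoning
  r = isqrt n
  h : ι (suc r) ≤ ι 2 * ι r
  h = begin
    ι (suc r)     ≡⟨ ι-suc r ⟩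
    1ℚ + ι r      ≤⟨ +-monoˡ-≤ (ι r) (1≤ι r {{isqrt-nonZero n}}) ⟩
    ι r + ι r     ≡⟨ solve 1 (λ r → r :+ r := con (ι 2) :* r) refl (ι r) ⟩
    ι 2 * ι r     ∎

-- ⌊√n⌋ᵃ n / nᵃ, a rational within a constant factor of √(n²⁻ᵃ).
scale : ℕ → (n : ℕ) .{{_ : NonZero n}} → ℚ
scale a n = (+ 1 / n) ^ a * (ι (isqrt n) ^ a * ι n)

module _ (a n : ℕ) .{{_ : NonZero n}} where
  private
    r = ι (isqrt n)
    e = + 1 / n
    q = n ^ᶻ (+ 2 ℤ.- + a)
    0≤q = nonNegative⁻¹ q {{PowerSign.^ᶻ-nonNegative n (+ 2 ℤ.- + a)}}
    0≤r = 0≤ι (isqrt n)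
    0≤e = 0≤/ 1 n

    e^a*n^a : e ^ a * ι n ^ a ≡ 1ℚ
    e^a*n^a = trans (sym (^-distrib-* e (ι n) a)) (trans (cong (_^ a) (1/n*n n)) (1^ a))

    -- In this form q differs from the square of `scale a n` only by having nᵃ in place of (r²)ᵃ, so
    -- both comparisons below come down to r² ≤ n ≤ (2r)².
    q≡ : q ≡ (e ^ a * e ^ a) * (ι n ^ a) * (ι n * ι n)
    q≡ = begin
      q                                               ≡⟨ sym (*-identityˡ q) ⟩
      1ℚ * q                                          ≡⟨ cong (_* q) (sym (cong₂ _*_ e^a*n^a e^a*n^a)) ⟩
      e ^ a * ι n ^ a * (e ^ a * ι n ^ a) * q         ≡⟨ solve 3 (λ e n q → e :* n :* (e :* n) :* q := e :* e :* n :* (n :* q)) refl (e ^ a) (ι n ^ a) q ⟩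
      (e ^ a * e ^ a) * (ι n ^ a) * (ι n ^ a * q)     ≡⟨ cong (λ z → (e ^ a * e ^ a) * (ι n ^ a) * z) (n^a*n^ᶻ n a) ⟩
      (e ^ a * e ^ a) * (ι n ^ a) * (ι n * ι n)       ∎
      where open ≡-Reasoning

    0≤ean² : 0ℚ ≤ (e ^ a * e ^ a) * (ι n * ι n)
    0≤ean² = 0≤* (0≤p² (e ^ a)) (0≤p² (ι n))

  0≤scale : 0ℚ ≤ scale a n
  0≤scale = 0≤* (0≤^ 0≤e a) (0≤* (0≤^ 0≤r a) (0≤ι n))

  -- The term `+ 1 / suc k` makes up for the rounding down in `√-seq`; it is later absorbed by the ε
  -- in `_≤ᴿ_`.
  scale≤√-seq : ∀ k → scale a n ≤ √-seq q k + + 1 / suc k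
  scale≤√-seq k = ²-cancel-≤ (0≤+ (0≤/ (√-num q k) (suc k)) (0≤/ 1 (suc k))) (begin
    scale a n * scale a n
      ≡⟨ solve 3 (λ e r n → e :* (r :* n) :* (e :* (r :* n)) := e :* e :* (n :* n) :* (r :* r)) refl (e ^ a) (r ^ a) (ι n) ⟩
    (e ^ a * e ^ a) * (ι n * ι n) * (r ^ a * r ^ a)
      ≤⟨ *-monoˡ 0≤ean² (subst (_≤ ι n ^ a) (^-distrib-* r r a) (^-mono (0≤p² r) (isqrt²≤ n) a)) ⟩
    (e ^ a * e ^ a) * (ι n * ι n) * ι n ^ a
      ≡⟨ solve 3 (λ e n m → e :* n :* m := e :* m :* n) refl (e ^ a * e ^ a) (ι n * ι n) (ι n ^ a) ⟩
    (e ^ a * e ^ a) * ι n ^ a * (ι n * ι n)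
      ≡⟨ sym q≡ ⟩
    q
      ≤⟨ ≤√-seq² q 0≤q k ⟩
    (√-seq q k + + 1 / suc k) * (√-seq q k + + 1 / suc k) ∎)
    where open ≤-Reasoning

  √-seq≤scale : ∀ k → √-seq q k ≤ ι 2 ^ a * scale a n
  √-seq≤scale k = ²-cancel-≤ (0≤* (0≤^ (0≤ι 2) a) 0≤scale) (begin
    √-seq q k * √-seq q k
      ≤⟨ √-seq²≤ q 0≤q k ⟩
    q
      ≡⟨ q≡ ⟩
    (e ^ a * e ^ a) * ι n ^ a * (ι n * ι n)
      ≡⟨ solve 3 (λ e n m → e :* m :* n := e :* n :* m) refl (e ^ a * e ^ a) (ι n * ι n) (ι n ^ a) ⟩
    (e ^ a * e ^ a) * (ι n * ι n) * ι n ^ a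
      ≤⟨ *-monoˡ 0≤ean² (^-mono (0≤ι n) (≤[2isqrt]² n) a) ⟩
    (e ^ a * e ^ a) * (ι n * ι n) * ((ι 2 * r) * (ι 2 * r)) ^ a
      ≡⟨ cong (λ z → (e ^ a * e ^ a) * (ι n * ι n) * z)
           (trans (^-distrib-* (ι 2 * r) (ι 2 * r) a) (cong₂ _*_ (^-distrib-* (ι 2) r a) (^-distrib-* (ι 2) r a))) ⟩
    (e ^ a * e ^ a) * (ι n * ι n) * ((ι 2 ^ a * r ^ a) * (ι 2 ^ a * r ^ a))
      ≡⟨ solve 4 (λ e n t r → e :* e :* (n :* n) :* ((t :* r) :* (t :* r)) := t :* (e :* (r :* n)) :* (t :* (e :* (r :* n)))) refl (e ^ a) (ι n) (ι 2 ^ a) (r ^ a) ⟩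
    (ι 2 ^ a * scale a n) * (ι 2 ^ a * scale a n) ∎)
    where open ≤-Reasoning

-- Averages over the grid

module _ (N : ℕ) .{{_ : NonZero N}} where

  grid : Fin N → ℚ
  grid j = + toℕ j / N

  mean-mono : ∀ {x y : Fin N → ℚ} → (∀ j → x j ≤ y j) → mean N x ≤ mean N y
  mean-mono h = *-monoˡ (0≤/ 1 N) (sum-mono h)

  mean-cong : ∀ {x y : Fin N → ℚ} → (∀ j → x j ≡ y j) → mean N x ≡ mean N y
  mean-cong h = cong (λ z → + 1 / N * z) (sum-cong-≗ h)

  mean-+ : ∀ (x y : Fin N → ℚ) → mean N (λ j → x j + y j) ≡ mean N x + mean N y
  mean-+ x y = trans (cong (λ z → + 1 / N * z) (∑-distrib-+ x y))
                     (*-distribˡ-+ (+ 1 / N) (sum x) (sum y))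

  mean-* : ∀ c (x : Fin N → ℚ) → mean N (λ j → c * x j) ≡ c * mean N x
  mean-* c x = begin
    + 1 / N * sum (λ j → c * x j)   ≡⟨ cong (λ z → + 1 / N * z) (sym (*-distribˡ-sum c x)) ⟩
    + 1 / N * (c * sum x)           ≡⟨ solve 3 (λ e c s → e :* (c :* s) := c :* (e :* s)) refl (+ 1 / N) c (sum x) ⟩
    c * (+ 1 / N * sum x)           ∎
    where open ≡-Reasoning

  mean-comm : ∀ (x : Fin N → Fin N → ℚ) →
              mean N (λ i → mean N (λ j → x i j)) ≡ mean N (λ j → mean N (λ i → x i j))
  mean-comm x = begin
    mean N (λ i → mean N (x i))                       ≡⟨ mean-* (+ 1 / N) (λ i → sum (x i)) ⟩
    + 1 / N * mean N (λ i → sum (x i))                ≡⟨ cong (λ z → + 1 / N * (+ 1 / N * z)) (∑-comm x) ⟩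
    + 1 / N * mean N (λ j → sum (λ i → x i j))        ≡⟨ sym (mean-* (+ 1 / N) (λ j → sum (λ i → x i j))) ⟩
    mean N (λ j → mean N (λ i → x i j))               ∎
    where open ≡-Reasoning

  gridMean-mono : ∀ {n} {f g : Vec ℚ n → ℚ} → (∀ u → f u ≤ g u) → gridMean N f ≤ gridMean N g
  gridMean-mono {zero}  h = h []
  gridMean-mono {suc n} h = mean-mono λ j → gridMean-mono λ u → h (grid j ∷ u)

  gridMean-≗ : ∀ {n} {f g : Vec ℚ n → ℚ} → (∀ u → f u ≡ g u) → gridMean N f ≡ gridMean N g
  gridMean-≗ {zero}  h = h []
  gridMean-≗ {suc n} h = mean-cong λ j → gridMean-≗ λ u → h (grid j ∷ u)

  gridMean-+ : ∀ {n} (f g : Vec ℚ n → ℚ) → gridMean N (λ u → f u + g u) ≡ gridMean N f + gridMean N g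
  gridMean-+ {zero}  f g = refl
  gridMean-+ {suc n} f g = trans
    (mean-cong λ j → gridMean-+ (λ u → f (grid j ∷ u)) (λ u → g (grid j ∷ u)))
    (mean-+ (λ j → gridMean N λ u → f (grid j ∷ u)) (λ j → gridMean N λ u → g (grid j ∷ u)))

  gridMean-* : ∀ {n} c (f : Vec ℚ n → ℚ) → gridMean N (λ u → c * f u) ≡ c * gridMean N f
  gridMean-* {zero}  c f = refl
  gridMean-* {suc n} c f = trans
    (mean-cong λ j → gridMean-* c (λ u → f (grid j ∷ u)))
    (mean-* c (λ j → gridMean N λ u → f (grid j ∷ u)))

  gridMean-const : ∀ {n} c → gridMean N {n} (λ _ → c) ≡ c
  gridMean-const {zero}  c = refl
  gridMean-const {suc n} c = trans (mean-cong λ j → gridMean-const {n} c) (mean-const N c)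

  gridMean-sum : ∀ {n m} (f : Fin m → Vec ℚ n → ℚ) →
                 gridMean N (λ u → sum (λ i → f i u)) ≡ sum (λ i → gridMean N (f i))
  gridMean-sum {n} {zero}  f = gridMean-const {n} 0ℚ
  gridMean-sum {n} {suc m} f = trans
    (gridMean-+ (f zero) (λ u → sum (λ i → f (suc i) u)))
    (cong (λ z → gridMean N (f zero) + z) (gridMean-sum (λ i → f (suc i))))

  -- Each coordinate is uniform and independent of the others.
  gridMean-insertAt : ∀ {n} (k : Fin (suc n)) (f : Vec ℚ (suc n) → ℚ) →
    gridMean N f ≡ mean N (λ j → gridMean N (λ u → f (insertAt u k (grid j))))
  gridMean-insertAt         zero    f = refl
  gridMean-insertAt {suc n} (suc k) f = trans
    (mean-cong λ i → gridMean-insertAt k (λ u → f (grid i ∷ u)))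
    (mean-comm (λ i j → gridMean N (λ u → f (grid i ∷ insertAt u k (grid j)))))

-- Sums over the coordinates of a vector

sumOver : (ℚ → ℚ) → List ℚ → ℚ
sumOver φ = List.foldr (λ x s → φ x + s) 0ℚ

-- Taken through lists so that invariance under the permutations of `_↭_` applies.
S : (ℚ → ℚ) → ∀ {n} → Vec ℚ n → ℚ
S φ u = sumOver φ (toList u)

S-insertAt : ∀ φ {n} (u : Vec ℚ n) k x → S φ (insertAt u k x) ≡ φ x + S φ u
S-insertAt φ u       zero    x = refl
S-insertAt φ (y ∷ u) (suc k) x = trans (cong (λ z → φ y + z) (S-insertAt φ u k x))
  (solve 3 (λ x y s → y :+ (x :+ s) := x :+ (y :+ s)) refl (φ x) (φ y) (S φ u))

S-lookup : ∀ φ {n} (u : Vec ℚ n) → sum (λ i → φ (lookup u i)) ≡ S φ u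
S-lookup φ []      = refl
S-lookup φ (x ∷ u) = cong (λ z → φ x + z) (S-lookup φ u)

S-shift : ∀ φ c {n} (u : Vec ℚ n) → S (λ x → φ x - c) u ≡ S φ u - ι n * c
S-shift φ c []      = sym (solve 1 (λ c → con 0ℚ :- con 0ℚ :* c := con 0ℚ) refl c)
S-shift φ c {suc n} (x ∷ u) = begin
  φ x - c + S (λ x → φ x - c) u    ≡⟨ cong (λ z → φ x - c + z) (S-shift φ c u) ⟩
  φ x - c + (S φ u - ι n * c)      ≡⟨ solve 4 (λ p c s n → p :- c :+ (s :- n :* c) := p :+ s :- (con 1ℚ :+ n) :* c) refl (φ x) c (S φ u) (ι n) ⟩
  φ x + S φ u - (1ℚ + ι n) * c     ≡⟨ cong (λ z → φ x + S φ u - z * c) (sym (ι-suc n)) ⟩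
  φ x + S φ u - ι (suc n) * c      ∎
  where open ≡-Reasoning

-- Moments of sums of independent centred bounded variables

-- Powers increase for x ≥ 1 and stay at most 1 for x ≤ 1. This and the next bound fold lower-order
-- terms of the moment recursion into the leading power plus 1.
x^m≤x^1+m+1 : ∀ {x} → 0ℚ ≤ x → ∀ m → x ^ m ≤ x ^ suc m + 1ℚ
x^m≤x^1+m+1 {x} 0≤x m with ≤-total 1ℚ x
... | inj₁ 1≤x = ≤-slack (0≤+ (0≤* (≤⇒0≤- 1≤x) (0≤^ 0≤x m)) 0≤1)
  (solve 2 (λ x p → x :* p :+ con 1ℚ := p :+ ((x :- con 1ℚ) :* p :+ con 1ℚ)) refl x (x ^ m))
... | inj₂ x≤1 = ≤-trans (subst (x ^ m ≤_) (1^ m) (^-mono 0≤x x≤1 m))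
  (≤-slack (0≤^ 0≤x (suc m)) (+-comm (x ^ suc m) 1ℚ))

x≤x^1+m+1 : ∀ {x} → 0ℚ ≤ x → ∀ m → x ≤ x ^ suc m + 1ℚ
x≤x^1+m+1 {x} 0≤x zero    = ≤-slack 0≤1 (cong (_+ 1ℚ) (*-identityʳ x))
x≤x^1+m+1 {x} 0≤x (suc m) with ≤-total 1ℚ x
... | inj₁ 1≤x = ≤-slack (0≤+ (0≤* 0≤x (≤⇒0≤- (subst (_≤ x ^ suc m) (1^ (suc m)) (^-mono 0≤1 1≤x (suc m))))) 0≤1)
  (solve 2 (λ x p → x :* p :+ con 1ℚ := x :+ (x :* (p :- con 1ℚ) :+ con 1ℚ)) refl x (x ^ suc m))
... | inj₂ x≤1 = ≤-trans x≤1 (≤-slack (0≤^ 0≤x (suc (suc m))) (+-comm (x ^ suc (suc m)) 1ℚ))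

-- `slope m` is 2(m+1), the coefficient of y s²ᵐ⁺¹ in (s+y)²ᵐ⁺². `growth` records what one induction
-- step of the next lemma costs: 1 + 4 `slope m` from `first` and 6 `growth m` from `second`.
slope growth : ℕ → ℚ
slope zero      = ι 2
slope (suc m)   = slope m + ι 2
growth zero     = 1ℚ
growth (suc m)  = 1ℚ + ι 4 * slope m + ι 6 * growth m

0≤slope : ∀ m → 0ℚ ≤ slope m
0≤slope zero    = 0≤ι 2
0≤slope (suc m) = 0≤+ (0≤slope m) (0≤ι 2)

0≤growth : ∀ m → 0ℚ ≤ growth m
0≤growth zero    = 0≤1
0≤growth (suc m) = 0≤+ (0≤+ 0≤1 (0≤* (0≤ι 4) (0≤slope m))) (0≤* (0≤ι 6) (0≤growth m))

-- The term linear in y vanishes on averaging over a centred y.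
[s+y]²^1+m≤ : ∀ m s y → y * y ≤ 1ℚ →
  ((s + y) * (s + y)) ^ suc m ≤
    (s * s) ^ suc m + y * (slope m * s * (s * s) ^ m) + growth m * ((s * s) ^ m + 1ℚ)
[s+y]²^1+m≤ zero s y y²≤1 = ≤-slack (0≤+ 0≤1 (≤⇒0≤- y²≤1))
  (solve 2 (λ s y →
     s :* s :* con 1ℚ :+ y :* (con (ι 2) :* s :* con 1ℚ) :+ con 1ℚ :* (con 1ℚ :+ con 1ℚ) :=
     (s :+ y) :* (s :+ y) :* con 1ℚ :+ (con 1ℚ :+ (con 1ℚ :- y :* y))) refl s y)
[s+y]²^1+m≤ (suc m) s y y²≤1 = begin
  w * w ^ suc m
    ≤⟨ *-monoˡ (0≤p² (s + y)) ([s+y]²^1+m≤ m s y y²≤1) ⟩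
  w * (x * P + y * (d * s * P) + G * (P + 1ℚ))
    -- Expanding w = x + 2ys + y² isolates the part linear in y, whose coefficient passes from d to
    -- d + 2; what remains contains y² or G as a factor.
    ≡⟨ solve 5 (λ s y d P G →
         let x = s :* s; w = (s :+ y) :* (s :+ y) in
         w :* (x :* P :+ y :* (d :* s :* P) :+ G :* (P :+ con 1ℚ)) :=
         x :* (x :* P) :+ y :* ((d :+ con (ι 2)) :* s :* (x :* P)) :+
           (y :* y :* (P :* (x :+ con (ι 2) :* d :* x :+ d :* (y :* s))) :+ w :* (G :* (P :+ con 1ℚ))))
       refl s y d P G ⟩
  x * (x * P) + y * ((d + ι 2) * s * (x * P)) +
    (y * y * (P * (x + ι 2 * d * x + d * (y * s))) + w * (G * (P + 1ℚ)))
    ≤⟨ +-monoʳ-≤ (x * (x * P) + y * ((d + ι 2) * s * (x * P))) (+-mono-≤ first second) ⟩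
  x * (x * P) + y * ((d + ι 2) * s * (x * P)) +
    ((1ℚ + ι 4 * d) * (x * P + 1ℚ) + ι 6 * G * (x * P + 1ℚ))
    ≡⟨ cong (λ z → x * (x * P) + y * ((d + ι 2) * s * (x * P)) + z)
         (sym (*-distribʳ-+ (x * P + 1ℚ) (1ℚ + ι 4 * d) (ι 6 * G))) ⟩
  x * (x * P) + y * ((d + ι 2) * s * (x * P)) + growth (suc m) * (x * P + 1ℚ) ∎
  where
  open ≤-Reasoning
  x = s * s
  w = (s + y) * (s + y)
  P = x ^ m
  d = slope m
  G = growth m
  0≤x = 0≤p² s
  0≤P = 0≤^ 0≤x m
  0≤d = 0≤slope m
  P≤ = x^m≤x^1+m+1 0≤x m
  x≤ = x≤x^1+m+1 0≤x m

  ys≤x+1 : y * s ≤ x + 1ℚ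
  ys≤x+1 = ≤-slack {d = ½ * ((s - y) * (s - y)) + ½ * x + ½ * (1ℚ - y * y) + ½ * 1ℚ}
    (0≤+ (0≤+ (0≤+ (0≤* (<⇒≤ 0<½) (0≤p² (s - y))) (0≤* (<⇒≤ 0<½) 0≤x))
      (0≤* (<⇒≤ 0<½) (≤⇒0≤- y²≤1))) (0≤* (<⇒≤ 0<½) 0≤1))
    (solve 2 (λ s y → s :* s :+ con 1ℚ :=
      y :* s :+ (con ½ :* ((s :- y) :* (s :- y)) :+ con ½ :* (s :* s) :+ con ½ :* (con 1ℚ :- y :* y) :+ con ½ :* con 1ℚ))
      refl s y)

  w≤2x+2 : w ≤ ι 2 * x + ι 2
  w≤2x+2 = ≤-slack {d = (s - y) * (s - y) + ι 2 * (1ℚ - y * y)}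
    (0≤+ (0≤p² (s - y)) (0≤* (0≤ι 2) (≤⇒0≤- y²≤1)))
    (solve 2 (λ s y → con (ι 2) :* (s :* s) :+ con (ι 2) :=
      (s :+ y) :* (s :+ y) :+ ((s :- y) :* (s :- y) :+ con (ι 2) :* (con 1ℚ :- y :* y))) refl s y)

  first : y * y * (P * (x + ι 2 * d * x + d * (y * s))) ≤ (1ℚ + ι 4 * d) * (x * P + 1ℚ)
  first = begin
    y * y * (P * (x + ι 2 * d * x + d * (y * s)))
      -- Bounding y s first makes the bracket nonnegative, which replacing y² by 1 requires.
      ≤⟨ *-monoˡ (0≤p² y) (*-monoˡ 0≤P (+-monoʳ-≤ (x + ι 2 * d * x) (*-monoˡ 0≤d ys≤x+1))) ⟩
    y * y * (P * (x + ι 2 * d * x + d * (x + 1ℚ)))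
      ≤⟨ *-monoʳ (0≤* 0≤P (0≤+ (0≤+ 0≤x (0≤* (0≤* (0≤ι 2) 0≤d) 0≤x)) (0≤* 0≤d (0≤+ 0≤x 0≤1)))) y²≤1 ⟩
    1ℚ * (P * (x + ι 2 * d * x + d * (x + 1ℚ)))
      ≤⟨ ≤-slack {d = d * (x * P + 1ℚ - P) + 1ℚ + ι 3 * d}
           (0≤+ (0≤+ (0≤* 0≤d (≤⇒0≤- P≤)) 0≤1) (0≤* (0≤ι 3) 0≤d))
           (solve 3 (λ x d P →
             (con 1ℚ :+ con (ι 4) :* d) :* (x :* P :+ con 1ℚ) :=
             con 1ℚ :* (P :* (x :+ con (ι 2) :* d :* x :+ d :* (x :+ con 1ℚ))) :+
               (d :* (x :* P :+ con 1ℚ :- P) :+ con 1ℚ :+ con (ι 3) :* d)) refl x d P) ⟩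
    (1ℚ + ι 4 * d) * (x * P + 1ℚ) ∎

  second : w * (G * (P + 1ℚ)) ≤ ι 6 * G * (x * P + 1ℚ)
  second = begin
    w * (G * (P + 1ℚ))
      ≤⟨ *-monoʳ (0≤* (0≤growth m) (0≤+ 0≤P 0≤1)) w≤2x+2 ⟩
    (ι 2 * x + ι 2) * (G * (P + 1ℚ))
      ≤⟨ ≤-slack {d = G * (ι 2 * (x * P + 1ℚ - P) + ι 2 * (x * P + 1ℚ - x))}
           (0≤* (0≤growth m) (0≤+ (0≤* (0≤ι 2) (≤⇒0≤- P≤)) (0≤* (0≤ι 2) (≤⇒0≤- x≤))))
           (solve 3 (λ x G P →
             con (ι 6) :* G :* (x :* P :+ con 1ℚ) :=
             (con (ι 2) :* x :+ con (ι 2)) :* (G :* (P :+ con 1ℚ)) :+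
               G :* (con (ι 2) :* (x :* P :+ con 1ℚ :- P) :+ con (ι 2) :* (x :* P :+ con 1ℚ :- x))) refl x G P) ⟩
    ι 6 * G * (x * P + 1ℚ) ∎

-- The summand `ι 4 * moment m` pays for an empty sum, where only z² ≤ 4 is known; the other summand
-- pays for adding one variable.
moment : ℕ → ℚ
moment zero    = 1ℚ
moment (suc m) = ι 4 * moment m + growth m * (moment m + 1ℚ)

1≤moment : ∀ m → 1ℚ ≤ moment m
1≤moment zero    = ≤-refl
1≤moment (suc m) = ≤-trans (1≤moment m) (≤-slack
  (0≤+ (0≤* (0≤ι 3) 0≤M) (0≤* (0≤growth m) (0≤+ 0≤M 0≤1)))
  (solve 2 (λ M G → con (ι 4) :* M :+ G :* (M :+ con 1ℚ) :=
    M :+ (con (ι 3) :* M :+ G :* (M :+ con 1ℚ))) refl (moment m) (growth m)))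
  where 0≤M = ≤-trans 0≤1 (1≤moment m)

0≤moment : ∀ m → 0ℚ ≤ moment m
0≤moment m = ≤-trans 0≤1 (1≤moment m)

4^m≤moment : ∀ m → ι 4 ^ m ≤ moment m
4^m≤moment zero    = ≤-refl
4^m≤moment (suc m) = ≤-trans (*-monoˡ (0≤ι 4) (4^m≤moment m))
  (≤-slack (0≤* (0≤growth m) (0≤+ (0≤moment m) 0≤1)) refl)

module _ (N : ℕ) .{{_ : NonZero N}} (φ : ℚ → ℚ)
         (centred : mean N (λ j → φ (grid N j)) ≡ 0ℚ) where

  private
    linear-vanishes : ∀ a b → mean N (λ j → a + φ (grid N j) * b) ≡ a
    linear-vanishes a b = begin
      mean N (λ j → a + φ (grid N j) * b)                  ≡⟨ mean-+ N (λ _ → a) (λ j → φ (grid N j) * b) ⟩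
      mean N (λ _ → a) + mean N (λ j → φ (grid N j) * b)   ≡⟨ cong₂ _+_ (mean-const N a) (mean-cong N λ j → *-comm (φ (grid N j)) b) ⟩
      a + mean N (λ j → b * φ (grid N j))                  ≡⟨ cong (λ z → a + z) (trans (mean-* N b (λ j → φ (grid N j))) (cong (b *_) centred)) ⟩
      a + b * 0ℚ                                           ≡⟨ solve 2 (λ a b → a :+ b :* con 0ℚ := a) refl a b ⟩
      a                                                    ∎
      where open ≡-Reasoning

  -- Double induction on m and n. Averaging over the first coordinate removes the linear term, so
  -- the offset z is unchanged. With ν = n + 1, the cost of one more variable is at most
  -- `growth m * (moment m + 1ℚ)` times νᵐ, hence at most `moment (suc m)` times νᵐ, and νᵐ⁺¹ + νᵐ ≤
  -- (ν+1)ᵐ⁺¹. Using n + 1 instead of n leaves room for z when n = 0.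
  gridMean-moment : (∀ j → φ (grid N j) * φ (grid N j) ≤ 1ℚ) →
    ∀ m {n} z → z * z ≤ ι 4 →
    gridMean N {n} (λ u → ((z + S φ u) * (z + S φ u)) ^ m) ≤ moment m * ι (suc n) ^ m
  gridMean-moment bounded zero    {n}    z z²≤4 = ≤-reflexive (trans (gridMean-const N {n} 1ℚ) (sym (*-identityˡ 1ℚ)))
  gridMean-moment bounded (suc m) {zero} z z²≤4 = begin
    ((z + 0ℚ) * (z + 0ℚ)) ^ suc m   ≡⟨ cong (λ z → (z * z) ^ suc m) (+-identityʳ z) ⟩
    (z * z) ^ suc m                 ≤⟨ ^-mono (0≤p² z) z²≤4 (suc m) ⟩
    ι 4 ^ suc m                     ≤⟨ 4^m≤moment (suc m) ⟩
    moment (suc m)                  ≡⟨ sym (trans (cong (moment (suc m) *_) (1^ (suc m))) (*-identityʳ _)) ⟩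
    moment (suc m) * 1ℚ ^ suc m     ∎
    where open ≤-Reasoning
  gridMean-moment bounded (suc m) {suc n} z z²≤4 = begin
    mean N (λ j → gridMean N {n} (λ u → ((z + (φ (grid N j) + S φ u)) * (z + (φ (grid N j) + S φ u))) ^ suc m))
      ≤⟨ mean-mono N (λ j → gridMean-mono N (λ u → pointwise j u)) ⟩
    mean N (λ j → gridMean N (λ u → q u ^ suc m + φ (grid N j) * l u + G * (q u ^ m + 1ℚ)))
      ≡⟨ mean-cong N (λ j → split (φ (grid N j))) ⟩
    mean N (λ j → M₁ + G * (M₀ + 1ℚ) + φ (grid N j) * gridMean N l)
      ≡⟨ linear-vanishes (M₁ + G * (M₀ + 1ℚ)) (gridMean N l) ⟩
    M₁ + G * (M₀ + 1ℚ)
      ≤⟨ +-mono-≤ (gridMean-moment bounded (suc m) {n} z z²≤4)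
           (*-monoˡ (0≤growth m) (+-mono-≤ (gridMean-moment bounded m {n} z z²≤4) 1≤ν^m)) ⟩
    C * (ν * ν ^ m) + G * (C′ * ν ^ m + ν ^ m)
      ≤⟨ ≤-slack {d = ι 4 * C′ * ν ^ m} (0≤* (0≤* (0≤ι 4) (0≤moment m)) 0≤ν^m)
           (solve 4 (λ C G ν p →
              let C₁ = con (ι 4) :* C :+ G :* (C :+ con 1ℚ) in
              C₁ :* (ν :* p :+ p) := C₁ :* (ν :* p) :+ G :* (C :* p :+ p) :+ con (ι 4) :* C :* p) refl C′ G ν (ν ^ m)) ⟩
    C * (ν * ν ^ m + ν ^ m)
      ≡⟨ cong (C *_) (trans (solve 2 (λ ν p → ν :* p :+ p := (con 1ℚ :+ ν) :* p) refl ν (ν ^ m)) (cong (_* ν ^ m) (sym (ι-suc (suc n))))) ⟩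
    C * (ι (suc (suc n)) * ν ^ m)
      ≤⟨ *-monoˡ (0≤moment (suc m)) (*-monoˡ (0≤ι (suc (suc n))) (^-mono (0≤ι (suc n)) (ι-mono (ℕ.n≤1+n (suc n))) m)) ⟩
    C * ι (suc (suc n)) ^ suc m ∎
    where
    open ≤-Reasoning
    G = growth m
    C = moment (suc m)
    C′ = moment m
    ν = ι (suc n)
    0≤ν^m = 0≤^ (0≤ι (suc n)) m
    1≤ν^m : 1ℚ ≤ ν ^ m
    1≤ν^m = subst (_≤ ν ^ m) (1^ m) (^-mono 0≤1 (1≤ι (suc n)) m)
    q l : Vec ℚ n → ℚ
    q u = (z + S φ u) * (z + S φ u)
    l u = slope m * (z + S φ u) * q u ^ m
    M₁ = gridMean N (λ u → q u ^ suc m)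
    M₀ = gridMean N (λ u → q u ^ m)
    pointwise : ∀ j u → ((z + (φ (grid N j) + S φ u)) * (z + (φ (grid N j) + S φ u))) ^ suc m ≤
                q u ^ suc m + φ (grid N j) * l u + G * (q u ^ m + 1ℚ)
    pointwise j u = ≤-trans
      (≤-reflexive (cong (λ v → (v * v) ^ suc m)
        (solve 3 (λ z y s → z :+ (y :+ s) := z :+ s :+ y) refl z (φ (grid N j)) (S φ u))))
      ([s+y]²^1+m≤ m (z + S φ u) (φ (grid N j)) (bounded j))
    split : ∀ y → gridMean N (λ u → q u ^ suc m + y * l u + G * (q u ^ m + 1ℚ)) ≡
            M₁ + G * (M₀ + 1ℚ) + y * gridMean N l
    split y = begin-equality
      gridMean N (λ u → q u ^ suc m + y * l u + G * (q u ^ m + 1ℚ))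
        ≡⟨ gridMean-+ N (λ u → q u ^ suc m + y * l u) (λ u → G * (q u ^ m + 1ℚ)) ⟩
      gridMean N (λ u → q u ^ suc m + y * l u) + gridMean N (λ u → G * (q u ^ m + 1ℚ))
        ≡⟨ cong₂ _+_ (trans (gridMean-+ N (λ u → q u ^ suc m) (λ u → y * l u)) (cong (λ v → M₁ + v) (gridMean-* N y l)))
             (trans (gridMean-* N G (λ u → q u ^ m + 1ℚ)) (cong (G *_)
               (trans (gridMean-+ N (λ u → q u ^ m) (λ _ → 1ℚ)) (cong (λ v → M₀ + v) (gridMean-const N {n} 1ℚ))))) ⟩
      M₁ + y * gridMean N l + G * (M₀ + 1ℚ)
        ≡⟨ solve 3 (λ a b c → a :+ b :+ c := a :+ c :+ b) refl M₁ (y * gridMean N l) (G * (M₀ + 1ℚ)) ⟩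
      M₁ + G * (M₀ + 1ℚ) + y * gridMean N l ∎

  -- An identity, since the lower bound needs the variance from below. Here the first coordinate is
  -- moved into the offset, and its cross term with z averages to 0.
  gridMean-² : ∀ {n} z → gridMean N {n} (λ u → (z + S φ u) * (z + S φ u)) ≡
               z * z + ι n * mean N (λ j → φ (grid N j) * φ (grid N j))
  gridMean-² {zero}  z = solve 2 (λ z v → (z :+ con 0ℚ) :* (z :+ con 0ℚ) := z :* z :+ con 0ℚ :* v) refl z (mean N (λ j → φ (grid N j) * φ (grid N j)))
  gridMean-² {suc n} z = begin
    mean N (λ j → gridMean N {n} (λ u → (z + (φ (grid N j) + S φ u)) * (z + (φ (grid N j) + S φ u))))
      ≡⟨ mean-cong N (λ j → trans
           (gridMean-≗ N {n} (λ u → cong (λ v → v * v) (sym (+-assoc z (φ (grid N j)) (S φ u)))))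
           (gridMean-² {n} (z + φ (grid N j)))) ⟩
    mean N (λ j → (z + φ (grid N j)) * (z + φ (grid N j)) + ι n * V)
      ≡⟨ mean-cong N (λ j → solve 3 (λ z y c → (z :+ y) :* (z :+ y) :+ c :=
           z :* z :+ c :+ y :* (con (ι 2) :* z) :+ y :* y) refl z (φ (grid N j)) (ι n * V)) ⟩
    mean N (λ j → z * z + ι n * V + φ (grid N j) * (ι 2 * z) + φ (grid N j) * φ (grid N j))
      ≡⟨ mean-+ N (λ j → z * z + ι n * V + φ (grid N j) * (ι 2 * z)) (λ j → φ (grid N j) * φ (grid N j)) ⟩
    mean N (λ j → z * z + ι n * V + φ (grid N j) * (ι 2 * z)) + V
      ≡⟨ cong (_+ V) (linear-vanishes (z * z + ι n * V) (ι 2 * z)) ⟩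
    z * z + ι n * V + V
      ≡⟨ solve 3 (λ z n V → z :+ n :* V :+ V := z :+ (con 1ℚ :+ n) :* V) refl (z * z) (ι n) V ⟩
    z * z + (1ℚ + ι n) * V
      ≡⟨ cong (λ v → z * z + v * V) (sym (ι-suc n)) ⟩
    z * z + ι (suc n) * V ∎
    where
    open ≡-Reasoning
    V = mean N (λ j → φ (grid N j) * φ (grid N j))

-- Order statistics and counting

𝟙 : ∀ {P : Set} → Dec P → ℚ
𝟙 P? = if does P? then 1ℚ else 0ℚ

0≤𝟙 : ∀ {P : Set} (P? : Dec P) → 0ℚ ≤ 𝟙 P?
0≤𝟙 (yes _) = 0≤1
0≤𝟙 (no  _) = ≤-refl

𝟙≤1 : ∀ {P : Set} (P? : Dec P) → 𝟙 P? ≤ 1ℚ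
𝟙≤1 (yes _) = ≤-refl
𝟙≤1 (no  _) = 0≤1

𝟙-yes : ∀ {P : Set} (P? : Dec P) → P → 𝟙 P? ≡ 1ℚ
𝟙-yes (yes _) _ = refl
𝟙-yes (no ¬p) p = contradiction p ¬p

𝟙-no : ∀ {P : Set} (P? : Dec P) → ¬ P → 𝟙 P? ≡ 0ℚ
𝟙-no (yes p) ¬p = contradiction p ¬p
𝟙-no (no  _) _  = refl

≤⇒≯ : ∀ {p q} → p ≤ q → ¬ q < p
≤⇒≯ p≤q q<p = <-irrefl refl (≤-<-trans p≤q q<p)

𝟙-⇔ : ∀ {P Q : Set} → P ⇔ Q → (P? : Dec P) (Q? : Dec Q) → 𝟙 P? ≡ 𝟙 Q?
𝟙-⇔ P⇔Q P? Q? = cong (if_then 1ℚ else 0ℚ) (does-⇔ P⇔Q P? Q?)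

#< #≤ : ℚ → ∀ {n} → Vec ℚ n → ℚ
#< x = S (λ y → 𝟙 (y <? x))
#≤ x = S (λ y → 𝟙 (y ≤? x))

0≤#≤ : ∀ x {n} (v : Vec ℚ n) → 0ℚ ≤ #≤ x v
0≤#≤ x []      = ≤-refl
0≤#≤ x (y ∷ v) = 0≤+ (0≤𝟙 (y ≤? x)) (0≤#≤ x v)

≤-lookup : ∀ {y n} (v : Vec ℚ n) → Sorted (y ∷ toList v) → ∀ i → y ≤ lookup v i
≤-lookup (x ∷ v) (y≤x ∷ _)  zero    = y≤x
≤-lookup (x ∷ v) (y≤x ∷ v↗) (suc i) = ≤-trans y≤x (≤-lookup v v↗ i)

#<-head : ∀ {x y n} (v : Vec ℚ n) → x ≤ y → Sorted (y ∷ toList v) → #< x (y ∷ v) ≤ 0ℚ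
#<-head {x} {y} []      x≤y v↗         = ≤-reflexive
  (trans (+-identityʳ (𝟙 (y <? x))) (𝟙-no (y <? x) (≤⇒≯ x≤y)))
#<-head {x} {y} (z ∷ v) x≤y (y≤z ∷ v↗) = ≤-trans
  (≤-reflexive (trans (cong (λ c → c + #< x (z ∷ v)) (𝟙-no (y <? x) (≤⇒≯ x≤y))) (+-identityˡ (#< x (z ∷ v)))))
  (#<-head v (≤-trans x≤y y≤z) v↗)

-- Only positions before i can hold strictly smaller entries; with ties the count may fall short of
-- i.
#<-lookup : ∀ {n} (v : Vec ℚ n) → Sorted (toList v) → ∀ i → #< (lookup v i) v ≤ ι (toℕ i)
#<-lookup (y ∷ v) v↗ zero    = #<-head v ≤-refl v↗
#<-lookup (y ∷ v) v↗ (suc i) = ≤-trans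
  (+-mono-≤ (𝟙≤1 (y <? lookup v i)) (#<-lookup v (Linked.tail v↗) i))
  (≤-reflexive (sym (ι-suc (toℕ i))))

-- Positions 0 to i all count; equal entries further on can only add to them.
≤#≤-lookup : ∀ {n} (v : Vec ℚ n) → Sorted (toList v) → ∀ i → ι (suc (toℕ i)) ≤ #≤ (lookup v i) v
≤#≤-lookup (y ∷ v) v↗ zero    = ≤-slack (0≤#≤ y v)
  (cong (λ c → c + #≤ y v) (𝟙-yes (y ≤? y) ≤-refl))
≤#≤-lookup (y ∷ v) v↗ (suc i) = begin
  ι (suc (suc (toℕ i)))                ≡⟨ ι-suc (suc (toℕ i)) ⟩
  1ℚ + ι (suc (toℕ i))                 ≤⟨ +-monoʳ-≤ 1ℚ (≤#≤-lookup v (Linked.tail v↗) i) ⟩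
  1ℚ + #≤ x v                          ≡⟨ cong (λ c → c + #≤ x v) (sym (𝟙-yes (y ≤? x) (≤-lookup v v↗ i))) ⟩
  #≤ x (y ∷ v)                         ∎
  where
  open ≤-Reasoning
  x = lookup v i

sumOver-↭ : ∀ φ {xs ys} → xs ↭ ys → sumOver φ xs ≡ sumOver φ ys
sumOver-↭ φ ↭.refl          = refl
sumOver-↭ φ (↭.prep x p)    = cong (λ z → φ x + z) (sumOver-↭ φ p)
sumOver-↭ φ (↭.swap {xs} {ys} x y p) = begin
  φ x + (φ y + sumOver φ xs)   ≡⟨ cong (λ z → φ x + (φ y + z)) (sumOver-↭ φ p) ⟩
  φ x + (φ y + sumOver φ ys)   ≡⟨ solve 3 (λ x y s → x :+ (y :+ s) := y :+ (x :+ s)) refl (φ x) (φ y) (sumOver φ ys) ⟩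
  φ y + (φ x + sumOver φ ys)   ∎
  where open ≡-Reasoning
sumOver-↭ φ (↭.trans p q)   = trans (sumOver-↭ φ p) (sumOver-↭ φ q)

module _ {n} (u : Vec ℚ n) where

  #<-X : ∀ i → #< (X i u) u ≤ ι (toℕ i)
  #<-X i = subst (λ x → #< x u ≤ ι (toℕ i)) (sym (X≡isort i u))
    (subst (_≤ ι (toℕ i)) (sumOver-↭ (λ y → 𝟙 (y <? x)) (isort-↭ u)) (#<-lookup (isort u) (isort-↗ u) i))
    where x = lookup (isort u) i

  ≤#≤-X : ∀ i → ι (suc (toℕ i)) ≤ #≤ (X i u) u
  ≤#≤-X i = subst (λ x → ι (suc (toℕ i)) ≤ #≤ x u) (sym (X≡isort i u))
    (subst (ι (suc (toℕ i)) ≤_) (sumOver-↭ (λ y → 𝟙 (y ≤? x)) (isort-↭ u)) (≤#≤-lookup (isort u) (isort-↗ u) i))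
    where x = lookup (isort u) i

  sum-X : ∀ φ → sum (λ i → φ (X i u)) ≡ S φ u
  sum-X φ = begin
    sum (λ i → φ (X i u))               ≡⟨ sum-cong-≗ (λ i → cong φ (X≡isort i u)) ⟩
    sum (λ i → φ (lookup (isort u) i))  ≡⟨ S-lookup φ (isort u) ⟩
    S φ (isort u)                       ≡⟨ sumOver-↭ φ (isort-↭ u) ⟩
    S φ u                               ∎
    where open ≡-Reasoning

  -- n (tᵢ - Xᵢ)
  gap : Fin n → ℚ
  gap i = ι (toℕ i) + ½ - ι n * X i u

-- At a grid point x, `below x` has mean exactly 0 over the grid, whereas `upTo x` has mean 1/N
-- because x itself is counted.
below upTo : ℚ → ℚ → ℚ
below x y = 𝟙 (y <? x) - x
upTo  x y = 𝟙 (y ≤? x) - x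

below≤gap : ∀ {n} (u : Vec ℚ n) i → S (below (X i u)) u ≤ gap u i
below≤gap {n} u i = begin
  S (below (X i u)) u                ≡⟨ S-shift (λ y → 𝟙 (y <? X i u)) (X i u) u ⟩
  #< (X i u) u - ι n * X i u         ≤⟨ +-monoˡ-≤ (- (ι n * X i u)) (≤-trans (#<-X u i) (≤-slack (<⇒≤ 0<½) refl)) ⟩
  ι (toℕ i) + ½ - ι n * X i u        ∎
  where open ≤-Reasoning

gap≤upTo : ∀ {n} (u : Vec ℚ n) i → gap u i ≤ S (upTo (X i u)) u
gap≤upTo {n} u i = begin
  ι (toℕ i) + ½ - ι n * X i u        ≤⟨ +-monoˡ-≤ (- (ι n * X i u)) (≤-trans (≤-slack {ι (toℕ i) + ½} (<⇒≤ 0<½) eq) (≤#≤-X u i)) ⟩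
  #≤ (X i u) u - ι n * X i u         ≡⟨ sym (S-shift (λ y → 𝟙 (y ≤? X i u)) (X i u) u) ⟩
  S (upTo (X i u)) u                 ∎
  where
  open ≤-Reasoning
  eq : ι (suc (toℕ i)) ≡ ι (toℕ i) + ½ + ½
  eq = trans (ι-suc (toℕ i)) (solve 1 (λ i → con 1ℚ :+ i := i :+ con ½ :+ con ½) refl (ι (toℕ i)))

∣X-t∣≡ : ∀ {n} .{{_ : NonZero n}} (u : Vec ℚ n) i → ∣ X i u - t n i ∣ ≡ + 1 / n * ∣ gap u i ∣
∣X-t∣≡ {n} u i = begin
  ∣ X i u - t n i ∣                      ≡⟨ cong ∣_∣ eq ⟩
  ∣ - (e * gap u i) ∣                    ≡⟨ ∣-p∣≡∣p∣ (e * gap u i) ⟩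
  ∣ e * gap u i ∣                        ≡⟨ ∣p*q∣≡∣p∣*∣q∣ e (gap u i) ⟩
  ∣ e ∣ * ∣ gap u i ∣                    ≡⟨ cong (_* ∣ gap u i ∣) (0≤p⇒∣p∣≡p (0≤/ 1 n)) ⟩
  e * ∣ gap u i ∣                        ∎
  where
  open ≡-Reasoning
  e = + 1 / n
  x = X i u
  k = ι (toℕ i)
  eq : X i u - t n i ≡ - (e * gap u i)
  eq = begin
    x - (+ suc (toℕ i) / n - (+ 1 / (2 ℕ.* n)) {{ℕ.m*n≢0 2 n}})
      ≡⟨ cong₂ (λ p q → x - (p - q)) (/≡1/* (suc (toℕ i)) n) (1/n*1/m 2 n) ⟩
    x - (e * ι (suc (toℕ i)) - ½ * e)
      ≡⟨ cong₂ (λ p q → p - (e * q - ½ * e)) (trans (sym (*-identityˡ x)) (cong (_* x) (sym (1/n*n n)))) (ι-suc (toℕ i)) ⟩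
    e * ι n * x - (e * (1ℚ + k) - ½ * e)
      ≡⟨ solve 4 (λ e n x k → e :* n :* x :- (e :* (con 1ℚ :+ k) :- con ½ :* e) :=
           con 0ℚ :- e :* (k :+ con ½ :- n :* x)) refl e (ι n) x k ⟩
    0ℚ - e * gap u i
      ≡⟨ +-identityˡ _ ⟩
    - (e * gap u i) ∎

-- Upper bound

-- According to the sign of Y, its absolute value is bounded by that of B or of A; adding the other
-- even power avoids a maximum.
between-² : ∀ {A Y B} → A ≤ Y → Y ≤ B → ∀ m → (Y * Y) ^ m ≤ (A * A) ^ m + (B * B) ^ m
between-² {A} {Y} {B} A≤Y Y≤B m with ≤-total 0ℚ Y
... | inj₁ 0≤Y = ≤-trans (^-mono (0≤p² Y) (*-mono 0≤Y Y≤B 0≤Y Y≤B) m)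
  (≤-slack (0≤^ (0≤p² A) m) (+-comm ((A * A) ^ m) ((B * B) ^ m)))
... | inj₂ Y≤0 = ≤-trans (^-mono (0≤p² Y) (≤-slack (0≤* (≤⇒0≤- A≤Y) (0≤+ (≤⇒0≤- Y≤0) (≤⇒0≤- (≤-trans A≤Y Y≤0))))
    (solve 2 (λ A Y → A :* A := Y :* Y :+ (Y :- A) :* (con 0ℚ :- Y :+ (con 0ℚ :- A))) refl A Y)) m)
  (≤-slack (0≤^ (0≤p² B) m) refl)

-- The left side is at most the larger of h and y to the power a + 1. The upper bound takes h near
-- √n and y a gap, trading the odd power for an even one; the lower bound exchanges the two roles.
h*y^a≤ : ∀ {h y} → 0ℚ ≤ h → 0ℚ ≤ y → ∀ a → h * y ^ a ≤ h ^ suc a + y ^ suc a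
h*y^a≤ {h} {y} 0≤h 0≤y a with ≤-total y h
... | inj₁ y≤h = ≤-trans (*-monoˡ 0≤h (^-mono 0≤y y≤h a)) (≤-slack (0≤^ 0≤y (suc a)) refl)
... | inj₂ h≤y = ≤-trans (*-monoʳ (0≤^ 0≤y a) h≤y) (≤-slack (0≤^ 0≤h (suc a)) (+-comm (h ^ suc a) (y ^ suc a)))

∣p∣^even : ∀ p {a} m → a ≡ m ℕ.+ m → ∣ p ∣ ^ a ≡ (p * p) ^ m
∣p∣^even p m refl = begin
  ∣ p ∣ ^ (m ℕ.+ m)         ≡⟨ ^-homo-* ∣ p ∣ m m ⟩
  ∣ p ∣ ^ m * ∣ p ∣ ^ m     ≡⟨ sym (^-distrib-* ∣ p ∣ ∣ p ∣ m) ⟩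
  (∣ p ∣ * ∣ p ∣) ^ m       ≡⟨ cong (_^ m) (∣p∣²≡p² p) ⟩
  (p * p) ^ m               ∎
  where open ≡-Reasoning

²≤4 : ∀ {z} → - ι 2 ≤ z → z ≤ ι 2 → z * z ≤ ι 4
²≤4 {z} -2≤z z≤2 = ≤-slack (0≤* (≤⇒0≤- z≤2) (≤⇒0≤- -2≤z))
  (solve 1 (λ z → con (ι 4) := z :* z :+ (con (ι 2) :- z) :* (z :- con (- ι 2))) refl z)

𝟙-²≤1 : ∀ {P : Set} (P? : Dec P) {p} → 0ℚ ≤ p → p ≤ 1ℚ → (𝟙 P? - p) * (𝟙 P? - p) ≤ 1ℚ
𝟙-²≤1 (yes _) {p} 0≤p p≤1 = ≤-slack (0≤* 0≤p (0≤+ 0≤1 (≤⇒0≤- p≤1)))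
  (solve 1 (λ p → con 1ℚ := (con 1ℚ :- p) :* (con 1ℚ :- p) :+ p :* (con 1ℚ :+ (con 1ℚ :- p))) refl p)
𝟙-²≤1 (no  _) {p} 0≤p p≤1 = ≤-slack (0≤* (0≤+ 0≤1 0≤p) (≤⇒0≤- p≤1))
  (solve 1 (λ p → con 1ℚ := (con 0ℚ :- p) :* (con 0ℚ :- p) :+ (con 1ℚ :+ p) :* (con 1ℚ :- p)) refl p)

sum-𝟙< : ∀ {N} j → j ℕ.≤ N → sum {N} (λ k → 𝟙 (toℕ k ℕ.<? j)) ≡ ι j
sum-𝟙< {zero}  zero    _         = refl
sum-𝟙< {suc N} zero    _         = cong (λ z → 0ℚ + z) (sum-𝟙< {N} zero z≤n)
sum-𝟙< {suc N} (suc j) (s≤s j≤N) = begin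
  1ℚ + sum {N} (λ k → 𝟙 (suc (toℕ k) ℕ.<? suc j))  ≡⟨ cong (λ z → 1ℚ + z) (sum-cong-≗ {N} (λ k → 𝟙-⇔ (mk⇔ ℕ.s<s⁻¹ s≤s) (suc (toℕ k) ℕ.<? suc j) (toℕ k ℕ.<? j))) ⟩
  1ℚ + sum {N} (λ k → 𝟙 (toℕ k ℕ.<? j))            ≡⟨ cong (λ z → 1ℚ + z) (sum-𝟙< j j≤N) ⟩
  1ℚ + ι j                                         ≡⟨ sym (ι-suc j) ⟩
  ι (suc j)                                        ∎
  where open ≡-Reasoning

module _ (N : ℕ) .{{_ : NonZero N}} where

  /-cancel-≤ : ∀ {i j} → + i / N ≤ + j / N → i ℕ.≤ j
  /-cancel-≤ {i} {j} h = ℕ.≮⇒≥ λ j<i → <-irrefl refl (begin-strict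
    ι i              ≤⟨ subst₂ _≤_ (ι*/ i N) (ι*/ j N) (*-monoˡ (0≤ι N) h) ⟩
    ι j              <⟨ ι-< ⟩
    1ℚ + ι j         ≡⟨ sym (ι-suc j) ⟩
    ι (suc j)        ≤⟨ ι-mono j<i ⟩
    ι i              ∎)
    where
    open ≤-Reasoning
    ι-< : ∀ {x} → x < 1ℚ + x
    ι-< {x} = subst (_< 1ℚ + x) (+-identityˡ x) (+-monoˡ-< x 0<1)

  grid-mono : ∀ {i j} → i ℕ.≤ j → + i / N ≤ + j / N
  grid-mono {i} {j} i≤j = /-≤ i N j N (ℕ.*-monoˡ-≤ N i≤j)

  -- A count j instead of a grid index covers the weak inequality too, for which it is one more than
  -- the index and may equal N.
  mean-𝟙-centred : ∀ {P : Fin N → Set} (P? : ∀ k → Dec (P k)) j → j ℕ.≤ N →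
    (∀ k → P k ⇔ toℕ k ℕ.< j) → mean N (λ k → 𝟙 (P? k) - + j / N) ≡ 0ℚ
  mean-𝟙-centred P? j j≤N h = begin
    mean N (λ k → 𝟙 (P? k) - c)                     ≡⟨ mean-+ N (λ k → 𝟙 (P? k)) (λ _ → - c) ⟩
    mean N (λ k → 𝟙 (P? k)) + mean N (λ _ → - c)    ≡⟨ cong₂ _+_ (cong (λ z → + 1 / N * z) (trans (sum-cong-≗ (λ k → 𝟙-⇔ (h k) (P? k) (toℕ k ℕ.<? j))) (sum-𝟙< j j≤N))) (mean-const N (- c)) ⟩
    + 1 / N * ι j - c                               ≡⟨ cong (λ z → z - c) (sym (/≡1/* j N)) ⟩
    c - c                                           ≡⟨ +-inverseʳ c ⟩
    0ℚ                                              ∎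
    where
    open ≡-Reasoning
    c = + j / N

  grid-< : ∀ {i j : Fin N} → grid N i < grid N j ⇔ toℕ i ℕ.< toℕ j
  grid-< {i} {j} = mk⇔
    (λ h → ℕ.≰⇒> λ j≤i → <-irrefl refl (<-≤-trans h (grid-mono j≤i)))
    (λ h → ≰⇒> λ j≤i → ℕ.<-irrefl refl (ℕ.<-≤-trans h (/-cancel-≤ j≤i)))

  grid-≤ : ∀ {i j : Fin N} → grid N i ≤ grid N j ⇔ toℕ i ℕ.< suc (toℕ j)
  grid-≤ = mk⇔ (λ h → s≤s (/-cancel-≤ h)) (λ h → grid-mono (ℕ.s≤s⁻¹ h))

  private
    e = + 1 / N
    0≤e = 0≤/ 1 N

  0≤grid : ∀ (j : Fin N) → 0ℚ ≤ grid N j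
  0≤grid j = 0≤/ (toℕ j) N

  /≤1 : ∀ {j} → j ℕ.≤ N → + j / N ≤ 1ℚ
  /≤1 {j} j≤N = ≤-trans (grid-mono j≤N) (≤-reflexive (n/n≡1 N))

  grid≤1 : ∀ (j : Fin N) → grid N j ≤ 1ℚ
  grid≤1 j = /≤1 (ℕ.<⇒≤ (Fin.toℕ<n j))

  -- The offset is the constant contributed by the coordinate fixed at x.
  below-moment : ∀ m {n} (j : Fin N) → let x = grid N j in
    gridMean N {n} (λ u → ((below x x + S (below x) u) * (below x x + S (below x) u)) ^ m) ≤ moment m * ι (suc n) ^ m
  below-moment m {n} j = gridMean-moment N (below x)
    (mean-𝟙-centred (λ k → grid N k <? x) (toℕ j) (ℕ.<⇒≤ (Fin.toℕ<n j)) (λ k → grid-<))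
    (λ k → 𝟙-²≤1 (grid N k <? x) (0≤grid j) (grid≤1 j))
    m {n} (below x x) (≤-trans (𝟙-²≤1 (x <? x) (0≤grid j) (grid≤1 j)) (ι-mono {1} {4} (s≤s z≤n)))
    where x = grid N j

  -- To be centred on the grid, the indicator must be shifted by x⁺ = x + 1/N. The n corrections sum
  -- to n/N ≤ 1 and join the offset, which then lies in [-2, 2].
  upTo-moment : ∀ m {n} → n ℕ.≤ N → (j : Fin N) → let x = grid N j in
    gridMean N {n} (λ u → ((upTo x x + S (upTo x) u) * (upTo x x + S (upTo x) u)) ^ m) ≤ moment m * ι (suc n) ^ m
  upTo-moment m {n} n≤N j = ≤-trans
    (≤-reflexive (gridMean-≗ N {n} (λ u → cong (λ v → (v * v) ^ m) (recentre u))))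
    (gridMean-moment N φ
      (mean-𝟙-centred (λ k → grid N k ≤? x) (suc (toℕ j)) (Fin.toℕ<n j) (λ k → grid-≤))
      (λ k → 𝟙-²≤1 (grid N k ≤? x) (0≤/ (suc (toℕ j)) N) (/≤1 (Fin.toℕ<n j)))
      m {n} z (²≤4 -2≤z z≤2))
    where
    open ≤-Reasoning
    x = grid N j
    x⁺ = + suc (toℕ j) / N
    φ : ℚ → ℚ
    φ y = 𝟙 (y ≤? x) - x⁺
    z = upTo x x + ι n * e
    ne≤1 : ι n * e ≤ 1ℚ
    ne≤1 = subst (_≤ 1ℚ) (trans (/≡1/* n N) (*-comm e (ι n))) (/≤1 n≤N)
    -2≤z : - ι 2 ≤ z
    -2≤z = ≤-slack {d = 𝟙 (x ≤? x) + (1ℚ - x) + 1ℚ + ι n * e}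
      (0≤+ (0≤+ (0≤+ (0≤𝟙 (x ≤? x)) (≤⇒0≤- (grid≤1 j))) 0≤1) (0≤* (0≤ι n) 0≤e))
      (solve 3 (λ i x c → i :- x :+ c := con (- ι 2) :+ (i :+ (con 1ℚ :- x) :+ con 1ℚ :+ c)) refl (𝟙 (x ≤? x)) x (ι n * e))
    z≤2 : z ≤ ι 2
    z≤2 = ≤-slack {d = 1ℚ - 𝟙 (x ≤? x) + x + (1ℚ - ι n * e)}
      (0≤+ (0≤+ (≤⇒0≤- (𝟙≤1 (x ≤? x))) (0≤grid j)) (≤⇒0≤- ne≤1))
      (solve 3 (λ i x c → con (ι 2) := i :- x :+ c :+ (con 1ℚ :- i :+ x :+ (con 1ℚ :- c))) refl (𝟙 (x ≤? x)) x (ι n * e))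
    recentre : ∀ u → upTo x x + S (upTo x) u ≡ z + S φ u
    recentre u = begin-equality
      upTo x x + S (upTo x) u
        ≡⟨ cong (λ v → upTo x x + v) (S-shift (λ y → 𝟙 (y ≤? x)) x u) ⟩
      upTo x x + (#≤ x u - ι n * x)
        ≡⟨ solve 5 (λ b s n x e → b :+ (s :- n :* x) := b :+ n :* e :+ (s :- n :* (e :+ x))) refl (upTo x x) (#≤ x u) (ι n) x e ⟩
      z + (#≤ x u - ι n * (e + x))
        ≡⟨ cong (λ v → z + (#≤ x u - ι n * v)) (sym (/-+ 1 (toℕ j) N)) ⟩
      z + (#≤ x u - ι n * x⁺)
        ≡⟨ cong (λ v → z + v) (sym (S-shift (λ y → 𝟙 (y ≤? x)) x⁺ u)) ⟩
      z + S φ u ∎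

  -- Conditionally on a coordinate x, the sum of ψ x over the others has the
  -- law of a sum of n independent terms.
  gridMean-S-self : ∀ (ψ : ℚ → ℚ → ℚ) m {n B} →
    (∀ (j : Fin N) → let x = grid N j in
      gridMean N {n} (λ u → ((ψ x x + S (ψ x) u) * (ψ x x + S (ψ x) u)) ^ m) ≤ B) →
    gridMean N {suc n} (λ u → S (λ x → (S (ψ x) u * S (ψ x) u) ^ m) u) ≤ ι (suc n) * B
  gridMean-S-self ψ m {n} {B} h = begin
    gridMean N (λ u → S (λ x → F x u) u)
      ≡⟨ gridMean-≗ N {suc n} (λ u → sym (S-lookup (λ x → F x u) u)) ⟩
    gridMean N (λ u → sum (λ k → F (lookup u k) u))
      ≡⟨ gridMean-sum N {suc n} (λ k u → F (lookup u k) u) ⟩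
    sum {suc n} (λ k → gridMean N (λ u → F (lookup u k) u))
      ≤⟨ sum-mono coordinate ⟩
    sum {suc n} (λ _ → B)
      ≡⟨ sum-const (suc n) B ⟩
    ι (suc n) * B ∎
    where
    open ≤-Reasoning
    F : ℚ → Vec ℚ (suc n) → ℚ
    F x u = (S (ψ x) u * S (ψ x) u) ^ m
    coordinate : ∀ k → gridMean N (λ u → F (lookup u k) u) ≤ B
    coordinate k = begin
      gridMean N (λ u → F (lookup u k) u)
        ≡⟨ gridMean-insertAt N k (λ u → F (lookup u k) u) ⟩
      mean N (λ j → gridMean N (λ u → F (lookup (insertAt u k (grid N j)) k) (insertAt u k (grid N j))))
        ≡⟨ mean-cong N (λ j → gridMean-≗ N {n} (λ u → trans
             (cong (λ x → F x (insertAt u k (grid N j))) (insertAt-lookup u k (grid N j)))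
             (cong (λ s → (s * s) ^ m) (S-insertAt (ψ (grid N j)) u k (grid N j))))) ⟩
      mean N (λ j → gridMean N {n} (λ u → ((ψ (grid N j) (grid N j) + S (ψ (grid N j)) u) * (ψ (grid N j) (grid N j) + S (ψ (grid N j)) u)) ^ m))
        ≤⟨ mean-mono N h ⟩
      mean N (λ _ → B)
        ≡⟨ mean-const N B ⟩
      B ∎

-- The 1 comes from rᵃ⁺¹, the factor 2 from the two sums `below` and `upTo`, and 2ᵃ⁺¹ from nᵐ ≤
-- (2r)ᵃ⁺¹ with 2m = a + 1.
upperConstant : ℕ → ℕ → ℚ
upperConstant a m = 1ℚ + ι 2 * (moment m * ι 2 ^ suc a)

0<upperConstant : ∀ a m → 0ℚ < upperConstant a m
0<upperConstant a m = <-≤-trans 0<1 (≤-slack (0≤* (0≤ι 2) (0≤* (0≤moment m) (0≤^ (0≤ι 2) (suc a)))) refl)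

sum-displacement≤ : ∀ {a m} → suc a ≡ m ℕ.+ m → ∀ {n N} .{{_ : NonZero n}} .{{_ : NonZero N}} → n ℕ.≤ N →
  sum {n} (λ i → gridMean N (λ u → ∣ X i u - t n i ∣ ^ a)) ≤ upperConstant a m * scale a n
sum-displacement≤ {a} {m} 1+a≡2m {suc n′} {N} n≤N = begin
  sum {n} (λ i → gridMean N (λ u → ∣ X i u - t n i ∣ ^ a))
    ≡⟨ sum-cong-≗ {n} (λ i → trans (gridMean-≗ N {n} (λ u → trans (cong (_^ a) (∣X-t∣≡ u i)) (^-distrib-* e ∣ gap u i ∣ a)))
         (gridMean-* N {n} (e ^ a) (λ u → ∣ gap u i ∣ ^ a))) ⟩
  sum {n} (λ i → e ^ a * gridMean N (λ u → ∣ gap u i ∣ ^ a))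
    ≡⟨ sym (*-distribˡ-sum {n} (e ^ a) (λ i → gridMean N (λ u → ∣ gap u i ∣ ^ a))) ⟩
  e ^ a * D
    -- The bound on D is proved after multiplication by r, which raises the odd exponent a to the
    -- even a + 1.
    ≤⟨ *-monoˡ (0≤^ (0≤/ 1 n) a) (*-cancel 0<r (begin
      r * D                                             ≤⟨ r*D≤ ⟩
      ν * r ^ suc a + ν * (M * ν ^ m) + ν * (M * ν ^ m) ≤⟨ +-mono-≤ (+-monoʳ-≤ (ν * r ^ suc a) ν*M) ν*M ⟩
      ν * (r * R) + ν * (M * (T * (r * R))) + ν * (M * (T * (r * R)))
        ≡⟨ solve 5 (λ r R ν M T → ν :* (r :* R) :+ ν :* (M :* (T :* (r :* R))) :+ ν :* (M :* (T :* (r :* R))) :=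
              r :* ((con 1ℚ :+ con (ι 2) :* (M :* T)) :* (R :* ν))) refl r R ν M T ⟩
      r * (upperConstant a m * (R * ν)) ∎)) ⟩
  e ^ a * (upperConstant a m * (R * ν))
    ≡⟨ solve 3 (λ e c x → e :* (c :* x) := c :* (e :* x)) refl (e ^ a) (upperConstant a m) (R * ν) ⟩
  upperConstant a m * scale a n ∎
  where
  open ≤-Reasoning
  n = suc n′
  e = + 1 / n
  ν = ι n
  r = ι (isqrt n)
  R = r ^ a
  M = moment m
  T = ι 2 ^ suc a
  0<r = 0<ι (isqrt n) {{isqrt-nonZero n}}
  D = sum {n} (λ i → gridMean N (λ u → ∣ gap u i ∣ ^ a))

  ν^m≤ : ν ^ m ≤ T * r ^ suc a
  ν^m≤ = begin
    ν ^ m                                     ≤⟨ ^-mono (0≤ι n) (≤[2isqrt]² n) m ⟩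
    ((ι 2 * r) * (ι 2 * r)) ^ m               ≡⟨ sym (∣p∣^even (ι 2 * r) m 1+a≡2m) ⟩
    ∣ ι 2 * r ∣ ^ suc a                       ≡⟨ cong (_^ suc a) (0≤p⇒∣p∣≡p (0≤* (0≤ι 2) (<⇒≤ 0<r))) ⟩
    (ι 2 * r) ^ suc a                         ≡⟨ ^-distrib-* (ι 2) r (suc a) ⟩
    T * r ^ suc a                             ∎

  ν*M : ν * (M * ν ^ m) ≤ ν * (M * (T * r ^ suc a))
  ν*M = *-monoˡ (0≤ι n) (*-monoˡ (0≤moment m) ν^m≤)

  F G : ℚ → Vec ℚ n → ℚ
  F x u = (S (below x) u * S (below x) u) ^ m
  G x u = (S (upTo x) u * S (upTo x) u) ^ m

  pointwise : ∀ u → r * sum (λ i → ∣ gap u i ∣ ^ a) ≤ ν * r ^ suc a + S (λ x → F x u) u + S (λ x → G x u) u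
  pointwise u = begin
    r * sum (λ i → ∣ gap u i ∣ ^ a)
      ≡⟨ *-distribˡ-sum r (λ i → ∣ gap u i ∣ ^ a) ⟩
    sum (λ i → r * ∣ gap u i ∣ ^ a)
      ≤⟨ sum-mono {n} (λ i → ≤-trans (h*y^a≤ (<⇒≤ 0<r) (0≤∣p∣ (gap u i)) a) (≤-trans
           (+-monoʳ-≤ (r ^ suc a) (≤-trans (≤-reflexive (∣p∣^even (gap u i) m 1+a≡2m)) (between-² (below≤gap u i) (gap≤upTo u i) m)))
           (≤-reflexive (sym (+-assoc (r ^ suc a) (F (X i u) u) (G (X i u) u)))))) ⟩
    sum (λ i → r ^ suc a + F (X i u) u + G (X i u) u)
      ≡⟨ trans (∑-distrib-+ (λ i → r ^ suc a + F (X i u) u) (λ i → G (X i u) u))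
           (cong₂ _+_ (∑-distrib-+ {n} (λ i → r ^ suc a) (λ i → F (X i u) u)) (sum-X u (λ x → G x u))) ⟩
    sum {n} (λ i → r ^ suc a) + sum (λ i → F (X i u) u) + S (λ x → G x u) u
      ≡⟨ cong₂ (λ p q → p + q + S (λ x → G x u) u) (sum-const n (r ^ suc a)) (sum-X u (λ x → F x u)) ⟩
    ν * r ^ suc a + S (λ x → F x u) u + S (λ x → G x u) u ∎

  r*D≤ : r * D ≤ ν * r ^ suc a + ν * (M * ν ^ m) + ν * (M * ν ^ m)
  r*D≤ = begin
    r * D
      ≡⟨ cong (r *_) (sym (gridMean-sum N {n} (λ i u → ∣ gap u i ∣ ^ a))) ⟩
    r * gridMean N {n} (λ u → sum (λ i → ∣ gap u i ∣ ^ a))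
      ≡⟨ sym (gridMean-* N {n} r (λ u → sum (λ i → ∣ gap u i ∣ ^ a))) ⟩
    gridMean N {n} (λ u → r * sum (λ i → ∣ gap u i ∣ ^ a))
      ≤⟨ gridMean-mono N {n} pointwise ⟩
    gridMean N {n} (λ u → ν * r ^ suc a + S (λ x → F x u) u + S (λ x → G x u) u)
      ≡⟨ trans (gridMean-+ N {n} (λ u → ν * r ^ suc a + S (λ x → F x u) u) (λ u → S (λ x → G x u) u))
           (cong (_+ gridMean N {n} (λ u → S (λ x → G x u) u)) (trans (gridMean-+ N {n} (λ u → ν * r ^ suc a) (λ u → S (λ x → F x u) u))
             (cong (_+ gridMean N {n} (λ u → S (λ x → F x u) u)) (gridMean-const N {n} (ν * r ^ suc a))))) ⟩
    ν * r ^ suc a + gridMean N {n} (λ u → S (λ x → F x u) u) + gridMean N {n} (λ u → S (λ x → G x u) u)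
      ≤⟨ +-mono-≤ (+-monoʳ-≤ (ν * r ^ suc a) (gridMean-S-self N below m {n′} (below-moment N m {n′})))
           (gridMean-S-self N upTo m {n′} (upTo-moment N m {n′} (ℕ.<⇒≤ n≤N))) ⟩
    ν * r ^ suc a + ν * (M * ν ^ m) + ν * (M * ν ^ m) ∎

-- Lower bound

-- The start x is arbitrary because splitting off the first term turns x into x + 1.
sum-progression : ∀ N x → ι 2 * sum {N} (λ j → x + ι (toℕ j)) ≡ ι N * (ι 2 * x + ι N - 1ℚ)
sum-progression zero    x = solve 1 (λ x → con 0ℚ := con 0ℚ :* (con (ι 2) :* x :+ con 0ℚ :- con 1ℚ)) refl x
sum-progression (suc N) x = begin
  ι 2 * (x + 0ℚ + sum {N} (λ j → x + ι (suc (toℕ j))))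
    ≡⟨ cong (λ s → ι 2 * (x + 0ℚ + s)) (sum-cong-≗ {N} (λ j → trans (cong (λ v → x + v) (ι-suc (toℕ j))) (sym (+-assoc x 1ℚ (ι (toℕ j)))))) ⟩
  ι 2 * (x + 0ℚ + sum {N} (λ j → x + 1ℚ + ι (toℕ j)))
    ≡⟨ *-distribˡ-+ (ι 2) (x + 0ℚ) (sum {N} (λ j → x + 1ℚ + ι (toℕ j))) ⟩
  ι 2 * (x + 0ℚ) + ι 2 * sum {N} (λ j → x + 1ℚ + ι (toℕ j))
    ≡⟨ cong (λ s → ι 2 * (x + 0ℚ) + s) (sum-progression N (x + 1ℚ)) ⟩
  ι 2 * (x + 0ℚ) + ι N * (ι 2 * (x + 1ℚ) + ι N - 1ℚ)
    ≡⟨ solve 2 (λ x n → con (ι 2) :* (x :+ con 0ℚ) :+ n :* (con (ι 2) :* (x :+ con 1ℚ) :+ n :- con 1ℚ) :=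
         (con 1ℚ :+ n) :* (con (ι 2) :* x :+ (con 1ℚ :+ n) :- con 1ℚ)) refl x (ι N) ⟩
  (1ℚ + ι N) * (ι 2 * x + (1ℚ + ι N) - 1ℚ)
    ≡⟨ cong (λ n → n * (ι 2 * x + n - 1ℚ)) (sym (ι-suc N)) ⟩
  ι (suc N) * (ι 2 * x + ι (suc N) - 1ℚ) ∎
  where open ≡-Reasoning

sum-progression² : ∀ N x → ι 6 * sum {N} (λ j → (x + ι (toℕ j)) * (x + ι (toℕ j))) ≡
  ι N * (ι 6 * (x * x) + ι 6 * x * (ι N - 1ℚ) + (ι N - 1ℚ) * (ι 2 * ι N - 1ℚ))
sum-progression² zero    x = solve 1 (λ x → con 0ℚ := con 0ℚ :* (con (ι 6) :* (x :* x) :+ con (ι 6) :* x :* (con 0ℚ :- con 1ℚ) :+ (con 0ℚ :- con 1ℚ) :* (con (ι 2) :* con 0ℚ :- con 1ℚ))) refl x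
sum-progression² (suc N) x = begin
  ι 6 * ((x + 0ℚ) * (x + 0ℚ) + sum {N} (λ j → (x + ι (suc (toℕ j))) * (x + ι (suc (toℕ j)))))
    ≡⟨ cong (λ s → ι 6 * ((x + 0ℚ) * (x + 0ℚ) + s)) (sum-cong-≗ {N} (λ j → cong (λ v → v * v) (trans (cong (λ v → x + v) (ι-suc (toℕ j))) (sym (+-assoc x 1ℚ (ι (toℕ j))))))) ⟩
  ι 6 * ((x + 0ℚ) * (x + 0ℚ) + T)
    ≡⟨ *-distribˡ-+ (ι 6) ((x + 0ℚ) * (x + 0ℚ)) T ⟩
  ι 6 * ((x + 0ℚ) * (x + 0ℚ)) + ι 6 * T
    ≡⟨ cong (λ s → ι 6 * ((x + 0ℚ) * (x + 0ℚ)) + s) (sum-progression² N (x + 1ℚ)) ⟩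
  ι 6 * ((x + 0ℚ) * (x + 0ℚ)) + ι N * (ι 6 * ((x + 1ℚ) * (x + 1ℚ)) + ι 6 * (x + 1ℚ) * (ι N - 1ℚ) + (ι N - 1ℚ) * (ι 2 * ι N - 1ℚ))
    ≡⟨ solve 2 (λ x n → let y = x :+ con 1ℚ; m = con 1ℚ :+ n in
         con (ι 6) :* ((x :+ con 0ℚ) :* (x :+ con 0ℚ)) :+ n :* (con (ι 6) :* (y :* y) :+ con (ι 6) :* y :* (n :- con 1ℚ) :+ (n :- con 1ℚ) :* (con (ι 2) :* n :- con 1ℚ)) :=
         m :* (con (ι 6) :* (x :* x) :+ con (ι 6) :* x :* (m :- con 1ℚ) :+ (m :- con 1ℚ) :* (con (ι 2) :* m :- con 1ℚ))) refl x (ι N) ⟩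
  (1ℚ + ι N) * (ι 6 * (x * x) + ι 6 * x * (1ℚ + ι N - 1ℚ) + (1ℚ + ι N - 1ℚ) * (ι 2 * (1ℚ + ι N) - 1ℚ))
    ≡⟨ cong (λ n → n * (ι 6 * (x * x) + ι 6 * x * (n - 1ℚ) + (n - 1ℚ) * (ι 2 * n - 1ℚ))) (sym (ι-suc N)) ⟩
  ι (suc N) * (ι 6 * (x * x) + ι 6 * x * (ι (suc N) - 1ℚ) + (ι (suc N) - 1ℚ) * (ι 2 * ι (suc N) - 1ℚ)) ∎
  where
  open ≡-Reasoning
  T = sum {N} (λ j → (x + 1ℚ + ι (toℕ j)) * (x + 1ℚ + ι (toℕ j)))

module _ (N : ℕ) .{{_ : NonZero N}} where
  private
    e = + 1 / N
    ν = ι N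
    0≤e = 0≤/ 1 N
    x₀ = - ½ * (ν - 1ℚ)

  -- The average of 0, 1/N, ..., (N-1)/N.
  gridCentre : ℚ
  gridCentre = ½ * (1ℚ - e)

  centred : ℚ → ℚ
  centred y = y - gridCentre

  private
    centred-grid : ∀ j → centred (grid N j) ≡ e * (x₀ + ι (toℕ j))
    centred-grid j = begin
      grid N j - ½ * (1ℚ - e)              ≡⟨ cong₂ (λ p q → p - ½ * (q - e)) (/≡1/* (toℕ j) N) (sym (1/n*n N)) ⟩
      e * ι (toℕ j) - ½ * (e * ν - e)      ≡⟨ solve 3 (λ e ν k → e :* k :- con ½ :* (e :* ν :- e) := e :* (con (- ½) :* (ν :- con 1ℚ) :+ k)) refl e ν (ι (toℕ j)) ⟩
      e * (x₀ + ι (toℕ j))                 ∎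
      where open ≡-Reasoning

  mean-centred : mean N (λ j → centred (grid N j)) ≡ 0ℚ
  mean-centred = begin
    mean N (λ j → centred (grid N j))              ≡⟨ mean-cong N centred-grid ⟩
    mean N (λ j → e * (x₀ + ι (toℕ j)))            ≡⟨ mean-* N e (λ j → x₀ + ι (toℕ j)) ⟩
    e * (e * T)                                    ≡⟨ solve 2 (λ e T → e :* (e :* T) := con ½ :* (e :* (e :* (con (ι 2) :* T)))) refl e T ⟩
    ½ * (e * (e * (ι 2 * T)))                      ≡⟨ cong (λ v → ½ * (e * (e * v))) (sum-progression N x₀) ⟩
    ½ * (e * (e * (ν * (ι 2 * x₀ + ν - 1ℚ))))      ≡⟨ solve 2 (λ e ν → con ½ :* (e :* (e :* (ν :* (con (ι 2) :* (con (- ½) :* (ν :- con 1ℚ)) :+ ν :- con 1ℚ)))) := con 0ℚ) refl e ν ⟩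
    0ℚ                                             ∎
    where
    open ≡-Reasoning
    T = sum {N} (λ j → x₀ + ι (toℕ j))

  -- The variance of N equally spaced points is (1 - 1/N²)/12, the discrete form of 1/12.
  12*mean-centred² : ι 12 * mean N (λ j → centred (grid N j) * centred (grid N j)) ≡ 1ℚ - e * e
  12*mean-centred² = begin
    ι 12 * mean N (λ j → centred (grid N j) * centred (grid N j))
      ≡⟨ cong (λ v → ι 12 * v) (mean-cong N (λ j → trans (cong₂ _*_ (centred-grid j) (centred-grid j))
           (solve 2 (λ e y → e :* y :* (e :* y) := e :* e :* (y :* y)) refl e (x₀ + ι (toℕ j))))) ⟩
    ι 12 * mean N (λ j → e * e * ((x₀ + ι (toℕ j)) * (x₀ + ι (toℕ j))))
      ≡⟨ cong (λ v → ι 12 * v) (mean-* N (e * e) (λ j → (x₀ + ι (toℕ j)) * (x₀ + ι (toℕ j)))) ⟩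
    ι 12 * (e * e * (e * T))
      ≡⟨ solve 2 (λ e T → con (ι 12) :* (e :* e :* (e :* T)) := con (ι 2) :* (e :* e :* (e :* (con (ι 6) :* T)))) refl e T ⟩
    ι 2 * (e * e * (e * (ι 6 * T)))
      ≡⟨ cong (λ v → ι 2 * (e * e * (e * v))) (sum-progression² N x₀) ⟩
    ι 2 * (e * e * (e * (ν * (ι 6 * (x₀ * x₀) + ι 6 * x₀ * (ν - 1ℚ) + (ν - 1ℚ) * (ι 2 * ν - 1ℚ)))))
      ≡⟨ solve 2 (λ e ν → let x = con (- ½) :* (ν :- con 1ℚ) in
           con (ι 2) :* (e :* e :* (e :* (ν :* (con (ι 6) :* (x :* x) :+ con (ι 6) :* x :* (ν :- con 1ℚ) :+ (ν :- con 1ℚ) :* (con (ι 2) :* ν :- con 1ℚ))))) :=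
           (e :* ν) :* ((e :* ν) :* (e :* ν) :- e :* e)) refl e ν ⟩
    (e * ν) * ((e * ν) * (e * ν) - e * e)
      ≡⟨ cong (λ v → v * (v * v - e * e)) (1/n*n N) ⟩
    1ℚ * (1ℚ * 1ℚ - e * e)
      ≡⟨ *-identityˡ _ ⟩
    1ℚ - e * e ∎
    where
    open ≡-Reasoning
    T = sum {N} (λ j → (x₀ + ι (toℕ j)) * (x₀ + ι (toℕ j)))

  centred²≤1 : ∀ j → centred (grid N j) * centred (grid N j) ≤ 1ℚ
  centred²≤1 j = ≤-slack {d = (y + (1ℚ - c)) * (1ℚ - y + c)}
    (0≤* (0≤+ (0≤grid N j) (≤⇒0≤- c≤1)) (0≤+ (≤⇒0≤- (grid≤1 N j)) 0≤c))
    (solve 2 (λ y c → con 1ℚ := (y :- c) :* (y :- c) :+ (y :+ (con 1ℚ :- c)) :* (con 1ℚ :- y :+ c)) refl y c)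
    where
    y = grid N j
    c = gridCentre
    e≤1 : e ≤ 1ℚ
    e≤1 = /-≤ 1 N 1 1 (ℕ.≤-trans (ℕ.>-nonZero⁻¹ N) (ℕ.≤-reflexive (sym (ℕ.*-identityˡ N))))
    0≤c : 0ℚ ≤ c
    0≤c = 0≤* (<⇒≤ 0<½) (≤⇒0≤- e≤1)
    c≤1 : c ≤ 1ℚ
    c≤1 = ≤-slack {d = ½ * (1ℚ + e)} (0≤* (<⇒≤ 0<½) (0≤+ 0≤1 0≤e))
      (solve 1 (λ e → con 1ℚ := con ½ :* (con 1ℚ :- e) :+ con ½ :* (con 1ℚ :+ e)) refl e)

  -- The variance is 0 at N = 1; from N = 2 on, 1 - 1/N² is at least 3/4, and (3/4)/12 = 1/16.
  1≤16*mean-centred² : 2 ℕ.≤ N → 1ℚ ≤ ι 16 * mean N (λ j → centred (grid N j) * centred (grid N j))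
  1≤16*mean-centred² 2≤N = *-cancel (0<ι 3) (begin
    ι 3 * 1ℚ                     ≤⟨ ≤-slack {d = ι 4 * ((½ - e) * (½ + e))} (0≤* (0≤ι 4) (0≤* (≤⇒0≤- e≤½) (0≤+ (<⇒≤ 0<½) 0≤e)))
                                      (solve 1 (λ e → con (ι 4) :* (con 1ℚ :- e :* e) := con (ι 3) :* con 1ℚ :+ con (ι 4) :* ((con ½ :- e) :* (con ½ :+ e))) refl e) ⟩
    ι 4 * (1ℚ - e * e)           ≡⟨ cong (λ v → ι 4 * v) (sym 12*mean-centred²) ⟩
    ι 4 * (ι 12 * V)             ≡⟨ solve 1 (λ V → con (ι 4) :* (con (ι 12) :* V) := con (ι 3) :* (con (ι 16) :* V)) refl V ⟩
    ι 3 * (ι 16 * V)             ∎)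
    where
    open ≤-Reasoning
    V = mean N (λ j → centred (grid N j) * centred (grid N j))
    e≤½ : e ≤ ½
    e≤½ = /-≤ 1 N 1 2 (ℕ.≤-trans 2≤N (ℕ.≤-reflexive (sym (ℕ.*-identityˡ N))))

-- Centred at 1/2, the mean of the anchors; `deviation≡` moves the difference from the grid mean
-- into an offset.
deviation : ∀ {n} → Vec ℚ n → ℚ
deviation = S (λ y → y - ½)

module _ {n N : ℕ} .{{_ : NonZero n}} .{{_ : NonZero N}} (n≤N : n ℕ.≤ N) where
  private
    e = + 1 / N
    ν = ι n
    z = - ½ * (ν * e)
    C = moment 2

    0≤ne : 0ℚ ≤ ν * e
    0≤ne = 0≤* (0≤ι n) (0≤/ 1 N)

    ne≤1 : ν * e ≤ 1ℚ
    ne≤1 = subst (_≤ 1ℚ) (trans (/≡1/* n N) (*-comm e ν)) (/≤1 N n≤N)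

    z²≤4 : z * z ≤ ι 4
    z²≤4 = ²≤4
      (≤-slack {d = ½ * (1ℚ - ν * e) + (ι 2 - ½)} (0≤+ (0≤* (<⇒≤ 0<½) (≤⇒0≤- ne≤1)) (≤⇒0≤- {½} {ι 2} (/-≤ 1 2 2 1 (s≤s z≤n))))
        (solve 1 (λ c → con (- ½) :* c := con (- ι 2) :+ (con ½ :* (con 1ℚ :- c) :+ (con (ι 2) :- con ½))) refl (ν * e)))
      (≤-slack {d = ι 2 + ½ * (ν * e)} (0≤+ (0≤ι 2) (0≤* (<⇒≤ 0<½) 0≤ne))
        (solve 1 (λ c → con (ι 2) := con (- ½) :* c :+ (con (ι 2) :+ con ½ :* c)) refl (ν * e)))

    deviation≡ : ∀ (u : Vec ℚ n) → deviation u ≡ z + S (centred N) u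
    deviation≡ u = begin
      deviation u                                  ≡⟨ S-shift id ½ u ⟩
      S id u - ν * ½                               ≡⟨ solve 3 (λ s ν e → s :- ν :* con ½ := con (- ½) :* (ν :* e) :+ (s :- ν :* (con ½ :* (con 1ℚ :- e)))) refl (S id u) ν e ⟩
      z + (S id u - ν * gridCentre N)              ≡⟨ cong (λ s → z + s) (sym (S-shift id (gridCentre N) u)) ⟩
      z + S (centred N) u                          ∎
      where open ≡-Reasoning

  n≤16E[deviation²] : 2 ℕ.≤ N → ι n ≤ ι 16 * gridMean N {n} (λ u → deviation u * deviation u)
  n≤16E[deviation²] 2≤N = begin
    ν                         ≡⟨ sym (*-identityʳ ν) ⟩
    ν * 1ℚ                    ≤⟨ *-monoˡ (0≤ι n) (1≤16*mean-centred² N 2≤N) ⟩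
    ν * (ι 16 * V)            ≤⟨ ≤-slack (0≤* (0≤ι 16) (0≤p² z)) (solve 3 (λ z ν V → con (ι 16) :* (z :* z :+ ν :* V) := ν :* (con (ι 16) :* V) :+ con (ι 16) :* (z :* z)) refl z ν V) ⟩
    ι 16 * (z * z + ν * V)    ≡⟨ cong (λ v → ι 16 * v) (sym (trans (gridMean-≗ N {n} (λ u → cong (λ s → s * s) (deviation≡ u))) (gridMean-² N (centred N) (mean-centred N) {n} z))) ⟩
    ι 16 * gridMean N {n} (λ u → deviation u * deviation u) ∎
    where
    open ≤-Reasoning
    V = mean N (λ j → centred N (grid N j) * centred N (grid N j))

  E[deviation⁴]≤ : gridMean N {n} (λ u → (deviation u * deviation u) ^ 2) ≤ C * (ι 4 * (ν * ν))
  E[deviation⁴]≤ = begin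
    gridMean N {n} (λ u → (deviation u * deviation u) ^ 2)
      ≡⟨ gridMean-≗ N {n} (λ u → cong (λ s → (s * s) ^ 2) (deviation≡ u)) ⟩
    gridMean N {n} (λ u → ((z + S (centred N) u) * (z + S (centred N) u)) ^ 2)
      ≤⟨ gridMean-moment N (centred N) (mean-centred N) (centred²≤1 N) 2 {n} z z²≤4 ⟩
    C * ι (suc n) ^ 2
      ≤⟨ *-monoˡ (0≤moment 2) (^-mono (0≤ι (suc n)) 1+n≤2n 2) ⟩
    C * (ι 2 * ν) ^ 2
      ≡⟨ cong (λ v → C * v) (solve 1 (λ n → con (ι 2) :* n :* (con (ι 2) :* n :* con 1ℚ) := con (ι 4) :* (n :* n)) refl ν) ⟩
    C * (ι 4 * (ν * ν)) ∎
    where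
    open ≤-Reasoning
    1+n≤2n : ι (suc n) ≤ ι 2 * ν
    1+n≤2n = begin
      ι (suc n)   ≡⟨ ι-suc n ⟩
      1ℚ + ν      ≤⟨ +-monoˡ-≤ ν (1≤ι n) ⟩
      ν + ν       ≡⟨ solve 1 (λ r → r :+ r := con (ι 2) :* r) refl ν ⟩
      ι 2 * ν     ∎

-- On averaging, bounds E|s| from below by the second and fourth moments.
L²s²≤ : ∀ {L} → 0ℚ ≤ L → ∀ s → L * L * (s * s) ≤ L * L * L * ∣ s ∣ + (s * s) ^ 2
L²s²≤ {L} 0≤L s = subst (λ q → L * L * q ≤ L * L * L * y + q ^ 2) (∣p∣²≡p² s) bound
  where
  y = ∣ s ∣
  0≤y = 0≤∣p∣ s
  bound : L * L * (y * y) ≤ L * L * L * y + (y * y) ^ 2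
  bound with ≤-total y L
  ... | inj₁ y≤L = ≤-slack (0≤+ (0≤* (0≤* (0≤p² L) 0≤y) (≤⇒0≤- y≤L)) (0≤^ (0≤p² y) 2))
    (solve 3 (λ L y q → L :* L :* L :* y :+ q := L :* L :* (y :* y) :+ (L :* L :* y :* (L :- y) :+ q)) refl L y ((y * y) ^ 2))
  ... | inj₂ L≤y = ≤-slack (0≤+ (0≤* (0≤* 0≤L (0≤p² L)) 0≤y) (0≤* (0≤p² y) (0≤* (≤⇒0≤- L≤y) (0≤+ 0≤y 0≤L))))
    (solve 2 (λ L y → L :* L :* L :* y :+ y :* y :* (y :* y :* con 1ℚ) :=
      L :* L :* (y :* y) :+ (L :* (L :* L) :* y :+ y :* y :* ((y :- L) :* (y :+ L)))) refl L y)

∣sum∣≤ : ∀ {n} (x : Fin n → ℚ) → ∣ sum x ∣ ≤ sum (λ i → ∣ x i ∣)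
∣sum∣≤ {zero}  x = ≤-refl
∣sum∣≤ {suc n} x = ≤-trans (∣p+q∣≤∣p∣+∣q∣ (x zero) (sum (λ i → x (suc i))))
  (+-monoʳ-≤ ∣ x zero ∣ (∣sum∣≤ (λ i → x (suc i))))

-- Sorting preserves sums, so the gaps add up to n ∑ⱼ (1/2 - uⱼ).
n∣deviation∣≤ : ∀ {n} (u : Vec ℚ n) → ι n * ∣ deviation u ∣ ≤ sum (λ i → ∣ gap u i ∣)
n∣deviation∣≤ {n} u = begin
  ν * ∣ deviation u ∣          ≡⟨ cong (_* ∣ deviation u ∣) (sym (0≤p⇒∣p∣≡p (0≤ι n))) ⟩
  ∣ ν ∣ * ∣ deviation u ∣      ≡⟨ sym (∣p*q∣≡∣p∣*∣q∣ ν (deviation u)) ⟩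
  ∣ ν * deviation u ∣          ≡⟨ sym (∣-p∣≡∣p∣ (ν * deviation u)) ⟩
  ∣ - (ν * deviation u) ∣      ≡⟨ cong ∣_∣ (sym sum-gap) ⟩
  ∣ sum (gap u) ∣              ≤⟨ ∣sum∣≤ (gap u) ⟩
  sum (λ i → ∣ gap u i ∣)      ∎
  where
  ν = ι n
  sum-gap : sum (gap u) ≡ - (ν * deviation u)
  sum-gap = begin
    sum (λ i → ι (toℕ i) + ½ - ν * X i u)
      ≡⟨ sum-cong-≗ (λ i → solve 3 (λ k ν x → k :+ con ½ :- ν :* x := con ½ :+ k :+ (con 0ℚ :- ν) :* x) refl (ι (toℕ i)) ν (X i u)) ⟩
    sum (λ i → ½ + ι (toℕ i) + (0ℚ - ν) * X i u)
      ≡⟨ ∑-distrib-+ (λ i → ½ + ι (toℕ i)) (λ i → (0ℚ - ν) * X i u) ⟩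
    P + sum (λ i → (0ℚ - ν) * X i u)
      ≡⟨ cong (λ s → P + s) (trans (sym (*-distribˡ-sum (0ℚ - ν) (λ i → X i u))) (cong (λ s → (0ℚ - ν) * s) (sum-X u id))) ⟩
    P + (0ℚ - ν) * S id u
      ≡⟨ solve 3 (λ P ν s → P :+ (con 0ℚ :- ν) :* s := con ½ :* (con (ι 2) :* P) :+ (con 0ℚ :- ν) :* s) refl P ν (S id u) ⟩
    ½ * (ι 2 * P) + (0ℚ - ν) * S id u
      ≡⟨ cong (λ p → ½ * p + (0ℚ - ν) * S id u) (sum-progression n ½) ⟩
    ½ * (ν * (ι 2 * ½ + ν - 1ℚ)) + (0ℚ - ν) * S id u
      ≡⟨ solve 2 (λ ν s → con ½ :* (ν :* (con (ι 2) :* con ½ :+ ν :- con 1ℚ)) :+ (con 0ℚ :- ν) :* s := con 0ℚ :- ν :* (s :- ν :* con ½)) refl ν (S id u) ⟩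
    0ℚ - ν * (S id u - ν * ½)
      ≡⟨ +-identityˡ _ ⟩
    - (ν * (S id u - ν * ½))
      ≡⟨ cong (λ s → - (ν * s)) (sym (S-shift id ½ u)) ⟩
    - (ν * deviation u) ∎
    where
    open ≡-Reasoning
    P = sum {n} (λ i → ½ + ι (toℕ i))
  open ≤-Reasoning

abstract
  -- Abstract, as evaluating these closed rationals is expensive.
  truncation : ℚ
  truncation = ι 512 * moment 2

  truncation≡ : truncation ≡ ι 512 * moment 2
  truncation≡ = refl

1≤truncation : 1ℚ ≤ truncation
1≤truncation = subst (1ℚ ≤_) (sym truncation≡) (*-mono 0≤1 (ι-mono {1} {512} (s≤s z≤n)) 0≤1 (1≤moment 2))

0<truncation : 0ℚ < truncation
0<truncation = <-≤-trans 0<1 1≤truncation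

-- `L²s²≤` is averaged at the level L = l r, with l = `truncation`. The second moment makes 32 L² E²
-- at least 2 l² r² n, while l is so large that 32 E⁴ takes away at most l r² n ≤ l² r² n. What is
-- left is at least l² r⁴ and at most 32 l³ r³ A.
E∣deviation∣≥ : ∀ {n N} .{{_ : NonZero n}} .{{_ : NonZero N}} → n ℕ.≤ N → 2 ℕ.≤ N →
  ι (isqrt n) ≤ ι 32 * truncation * gridMean N {n} (λ u → ∣ deviation u ∣)
E∣deviation∣≥ {n} {N} n≤N 2≤N = *-cancel (0<* (0<* 0<λ 0<λ) (0<* 0<r (0<* 0<r 0<r))) (begin
  l * l * (r * (r * r)) * r
    ≡⟨ solve 2 (λ l r → l :* l :* (r :* (r :* r)) :* r := l :* l :* (r :* r) :* (r :* r)) refl l r ⟩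
  l * l * (r * r) * (r * r)
    ≤⟨ *-monoˡ (0≤* (0≤p² l) (0≤p² r)) (isqrt²≤ n) ⟩
  l * l * (r * r) * ν
    ≤⟨ ≤-slack {d = ν * (r * r) * l * (l - 1ℚ)} (0≤* (0≤* (0≤* (0≤ι n) (0≤p² r)) (<⇒≤ 0<λ)) (≤⇒0≤- 1≤truncation))
         (solve 3 (λ l r ν → con (ι 2) :* (l :* l :* (r :* r) :* ν) :- l :* ν :* (r :* r) := l :* l :* (r :* r) :* ν :+ ν :* (r :* r) :* l :* (l :- con 1ℚ)) refl l r ν) ⟩
  ι 2 * (l * l * (r * r) * ν) - l * ν * (r * r)
    ≤⟨ +-mono-≤ (*-monoˡ (0≤ι 2) (*-monoˡ (0≤* (0≤p² l) (0≤p² r)) (n≤16E[deviation²] n≤N 2≤N))) (neg-antimono-≤ fourth) ⟩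
  ι 2 * (l * l * (r * r) * (ι 16 * E²)) - ι 32 * E⁴
    ≡⟨ solve 4 (λ l r a b → con (ι 2) :* (l :* l :* (r :* r) :* (con (ι 16) :* a)) :- con (ι 32) :* b :=
         con (ι 32) :* (l :* r :* (l :* r) :* a :- b)) refl l r E² E⁴ ⟩
  ι 32 * (L * L * E² - E⁴)
    ≤⟨ *-monoˡ (0≤ι 32) (≤-trans (+-monoˡ-≤ (- E⁴) averaged) (≤-reflexive (solve 2 (λ a b → a :+ b :- b := a) refl (L * L * L * A) E⁴))) ⟩
  ι 32 * (L * L * L * A)
    ≡⟨ solve 3 (λ l r A → con (ι 32) :* (l :* r :* (l :* r) :* (l :* r) :* A) := l :* l :* (r :* (r :* r)) :* (con (ι 32) :* l :* A)) refl l r A ⟩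
  l * l * (r * (r * r)) * (ι 32 * l * A) ∎)
  where
  open ≤-Reasoning
  l = truncation
  r = ι (isqrt n)
  ν = ι n
  L = l * r
  0<λ = 0<truncation
  0<r = 0<ι (isqrt n) {{isqrt-nonZero n}}
  0≤L = 0≤* (<⇒≤ 0<λ) (<⇒≤ 0<r)
  A = gridMean N {n} (λ u → ∣ deviation u ∣)
  E² = gridMean N {n} (λ u → deviation u * deviation u)
  E⁴ = gridMean N {n} (λ u → (deviation u * deviation u) ^ 2)

  averaged : L * L * E² ≤ L * L * L * A + E⁴
  averaged = begin
    L * L * E²                 ≡⟨ sym (gridMean-* N {n} (L * L) (λ u → deviation u * deviation u)) ⟩
    gridMean N {n} (λ u → L * L * (deviation u * deviation u))
      ≤⟨ gridMean-mono N {n} (λ u → L²s²≤ 0≤L (deviation u)) ⟩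
    gridMean N {n} (λ u → L * L * L * ∣ deviation u ∣ + (deviation u * deviation u) ^ 2)
      ≡⟨ trans (gridMean-+ N {n} (λ u → L * L * L * ∣ deviation u ∣) (λ u → (deviation u * deviation u) ^ 2))
           (cong (_+ E⁴) (gridMean-* N {n} (L * L * L) (λ u → ∣ deviation u ∣))) ⟩
    L * L * L * A + E⁴ ∎

  fourth : ι 32 * E⁴ ≤ l * ν * (r * r)
  fourth = begin
    ι 32 * E⁴                                        ≤⟨ *-monoˡ (0≤ι 32) (E[deviation⁴]≤ n≤N) ⟩
    ι 32 * (moment 2 * (ι 4 * (ν * ν)))              ≤⟨ *-monoˡ (0≤ι 32) (*-monoˡ (0≤moment 2) (*-monoˡ (0≤ι 4) (*-monoˡ (0≤ι n) (≤[2isqrt]² n)))) ⟩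
    ι 32 * (moment 2 * (ι 4 * (ν * ((ι 2 * r) * (ι 2 * r)))))
      -- 32 · 4 · 2² = 512 is the factor in `truncation`.
      ≡⟨ solve 3 (λ M ν r → con (ι 32) :* (M :* (con (ι 4) :* (ν :* ((con (ι 2) :* r) :* (con (ι 2) :* r))))) := con (ι 512) :* M :* ν :* (r :* r)) refl (moment 2) ν r ⟩
    ι 512 * moment 2 * ν * (r * r)                   ≡⟨ cong (λ v → v * ν * (r * r)) (sym truncation≡) ⟩
    l * ν * (r * r) ∎

abstract
  private instance
    64truncation-positive : Positive (ι 64 * truncation)
    64truncation-positive = positive (0<* (0<ι 64) 0<truncation)
    64truncation-nonZero : ℚ.NonZero (ι 64 * truncation)
    64truncation-nonZero = pos⇒nonZero (ι 64 * truncation)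

  -- Half of the factor 1/(32 `truncation`) from `E∣deviation∣≥`, so that h = κ r satisfies 2h ≤ A.
  lowerConstant : ℚ
  lowerConstant = 1/ (ι 64 * truncation)

  0<lowerConstant : 0ℚ < lowerConstant
  0<lowerConstant = positive⁻¹ lowerConstant {{1/pos⇒pos (ι 64 * truncation)}}

  lowerConstant*64truncation : lowerConstant * (ι 64 * truncation) ≡ 1ℚ
  lowerConstant*64truncation = *-inverseˡ (ι 64 * truncation)

sum-displacement≥ : ∀ b {a} → a ≡ suc b → ∀ {n N} .{{_ : NonZero n}} .{{_ : NonZero N}} → n ℕ.≤ N → 2 ℕ.≤ N →
  lowerConstant ^ a * scale a n ≤ sum {n} (λ i → gridMean N (λ u → ∣ X i u - t n i ∣ ^ a))
sum-displacement≥ b refl {n} {N} n≤N 2≤N = begin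
  κ ^ a * scale a n
    ≡⟨ solve 4 (λ κ e r ν → κ :* (e :* (r :* ν)) := e :* (ν :* (κ :* r))) refl (κ ^ a) (e ^ a) (r ^ a) ν ⟩
  e ^ a * (ν * (κ ^ a * r ^ a))
    ≡⟨ cong (λ p → e ^ a * (ν * p)) (sym (^-distrib-* κ r a)) ⟩
  e ^ a * (ν * h ^ a)
    ≤⟨ *-monoˡ (0≤^ (0≤/ 1 n) a) νh^a≤D ⟩
  e ^ a * D
    ≡⟨ *-distribˡ-sum {n} (e ^ a) (λ i → gridMean N (λ u → ∣ gap u i ∣ ^ a)) ⟩
  sum {n} (λ i → e ^ a * gridMean N (λ u → ∣ gap u i ∣ ^ a))
    ≡⟨ sum-cong-≗ {n} (λ i → sym (trans (gridMean-≗ N {n} (λ u → trans (cong (_^ a) (∣X-t∣≡ u i)) (^-distrib-* e ∣ gap u i ∣ a)))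
         (gridMean-* N {n} (e ^ a) (λ u → ∣ gap u i ∣ ^ a)))) ⟩
  sum {n} (λ i → gridMean N (λ u → ∣ X i u - t n i ∣ ^ a)) ∎
  where
  open ≤-Reasoning
  a = suc b
  e = + 1 / n
  ν = ι n
  r = ι (isqrt n)
  κ = lowerConstant
  h = κ * r
  0≤h = 0≤* (<⇒≤ 0<lowerConstant) (0≤ι (isqrt n))
  A = gridMean N {n} (λ u → ∣ deviation u ∣)
  D = sum {n} (λ i → gridMean N (λ u → ∣ gap u i ∣ ^ a))

  2h≤A : ι 2 * h ≤ A
  2h≤A = begin
    ι 2 * (κ * r)                              ≤⟨ *-monoˡ (0≤ι 2) (*-monoˡ (<⇒≤ 0<lowerConstant) (E∣deviation∣≥ {n} n≤N 2≤N)) ⟩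
    ι 2 * (κ * (ι 32 * truncation * A))        ≡⟨ solve 3 (λ κ l A → con (ι 2) :* (κ :* (con (ι 32) :* l :* A)) := κ :* (con (ι 64) :* l) :* A) refl κ truncation A ⟩
    κ * (ι 64 * truncation) * A                ≡⟨ cong (_* A) lowerConstant*64truncation ⟩
    1ℚ * A                                     ≡⟨ *-identityˡ A ⟩
    A                                          ∎

  pointwise : ∀ (u : Vec ℚ n) → h ^ b * ν * ∣ deviation u ∣ ≤ sum (λ i → ∣ gap u i ∣ ^ a) + ν * h ^ a
  pointwise u = begin
    h ^ b * ν * ∣ deviation u ∣
      ≡⟨ *-assoc (h ^ b) ν ∣ deviation u ∣ ⟩
    h ^ b * (ν * ∣ deviation u ∣)
      ≤⟨ *-monoˡ (0≤^ 0≤h b) (n∣deviation∣≤ u) ⟩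
    h ^ b * sum (λ i → ∣ gap u i ∣)
      ≡⟨ *-distribˡ-sum (h ^ b) (λ i → ∣ gap u i ∣) ⟩
    sum (λ i → h ^ b * ∣ gap u i ∣)
      ≤⟨ sum-mono {n} (λ i → ≤-trans (≤-reflexive (*-comm (h ^ b) ∣ gap u i ∣)) (h*y^a≤ (0≤∣p∣ (gap u i)) 0≤h b)) ⟩
    sum (λ i → ∣ gap u i ∣ ^ a + h ^ a)
      ≡⟨ ∑-distrib-+ {n} (λ i → ∣ gap u i ∣ ^ a) (λ _ → h ^ a) ⟩
    sum (λ i → ∣ gap u i ∣ ^ a) + sum {n} (λ _ → h ^ a)
      ≡⟨ cong (λ s → sum (λ i → ∣ gap u i ∣ ^ a) + s) (sum-const n (h ^ a)) ⟩
    sum (λ i → ∣ gap u i ∣ ^ a) + ν * h ^ a ∎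

  averaged : h ^ b * ν * A ≤ D + ν * h ^ a
  averaged = begin
    h ^ b * ν * A
      ≡⟨ sym (gridMean-* N {n} (h ^ b * ν) (λ u → ∣ deviation u ∣)) ⟩
    gridMean N {n} (λ u → h ^ b * ν * ∣ deviation u ∣)
      ≤⟨ gridMean-mono N {n} pointwise ⟩
    gridMean N {n} (λ u → sum (λ i → ∣ gap u i ∣ ^ a) + ν * h ^ a)
      ≡⟨ trans (gridMean-+ N {n} (λ u → sum (λ i → ∣ gap u i ∣ ^ a)) (λ _ → ν * h ^ a))
           (cong₂ _+_ (gridMean-sum N {n} (λ i u → ∣ gap u i ∣ ^ a)) (gridMean-const N {n} (ν * h ^ a))) ⟩
    D + ν * h ^ a ∎

  νh^a≤D : ν * h ^ a ≤ D
  νh^a≤D = begin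
    -- By 2h ≤ A the left side of `averaged` is at least 2νhᵃ; one νhᵃ remains after subtracting the
    -- error term.
    ν * (h * h ^ b)                                   ≡⟨ solve 3 (λ ν h p → ν :* (h :* p) := p :* ν :* (con (ι 2) :* h) :- ν :* (h :* p)) refl ν h (h ^ b) ⟩
    h ^ b * ν * (ι 2 * h) - ν * h ^ a                 ≤⟨ +-monoˡ-≤ (- (ν * h ^ a)) (≤-trans (*-monoˡ (0≤* (0≤^ 0≤h b) (0≤ι n)) 2h≤A) averaged) ⟩
    D + ν * h ^ a - ν * h ^ a                         ≡⟨ solve 2 (λ D p → D :+ p :- p := D) refl D (ν * h ^ a) ⟩
    D                                                 ∎

-- From bounds on every fine grid to the asymptotic statement

odd : ∀ a → 2 ∤ a → ∃ λ m → a ≡ suc (m ℕ.+ m)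
odd zero          2∤a = contradiction (divides 0 refl) 2∤a
odd (suc zero)    2∤a = 0 , refl
odd (suc (suc a)) 2∤a with odd a (λ 2∣a → 2∤a (∣m∣n⇒∣m+n (divides 1 refl) 2∣a))
... | m , refl = suc m , cong (λ k → suc (suc k)) (sym (ℕ.+-suc m m))

seq-∑ᴿ : ∀ {n} (f : Fin n → ℝ) k → seq (∑ᴿ f) k ≡ sum (λ i → seq (f i) k)
seq-∑ᴿ {zero}  f k = refl
seq-∑ᴿ {suc n} f k = cong (λ s → seq (f zero) k + s) (seq-∑ᴿ (λ i → f (suc i)) k)

module _ (a : ℕ) where

  seq-displacement : ∀ n .{{_ : NonZero n}} k →
    seq (∑ᴿ λ i → E (λ u → ∣ X i u - t n i ∣ ^ a) (displacement-continuous a i)) k ≡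
    sum {n} (λ i → gridMean (suc k) (λ u → ∣ X i u - t n i ∣ ^ a))
  seq-displacement n k = seq-∑ᴿ {n} _ k

  seq-displacement≥ : ∀ b → a ≡ suc b → ∀ n .{{_ : NonZero n}} k → n ℕ.≤ k →
    lowerConstant ^ a * scale a n ≤ seq (∑ᴿ λ i → E (λ u → ∣ X i u - t n i ∣ ^ a) (displacement-continuous a i)) k
  seq-displacement≥ b a≡1+b n {{n≢0}} k n≤k = ≤-trans
    -- Term k of the sequence uses the grid size N = k + 1, so 1 ≤ n ≤ k gives both n ≤ N and 2 ≤ N.
    (sum-displacement≥ b {a} a≡1+b {n} {suc k} {{n≢0}} (ℕ.m≤n⇒m≤1+n n≤k) (s≤s (ℕ.≤-trans (ℕ.>-nonZero⁻¹ n) n≤k)))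
    (≤-reflexive (sym (seq-displacement n {{n≢0}} k)))

  seq-displacement≤ : ∀ m → suc a ≡ m ℕ.+ m → ∀ n .{{_ : NonZero n}} k → n ℕ.≤ k →
    seq (∑ᴿ λ i → E (λ u → ∣ X i u - t n i ∣ ^ a) (displacement-continuous a i)) k ≤ upperConstant a m * scale a n
  seq-displacement≤ m 1+a≡2m n {{n≢0}} k n≤k = ≤-trans
    (≤-reflexive (seq-displacement n {{n≢0}} k))
    (sum-displacement≤ {a} {m} 1+a≡2m {n} {suc k} {{n≢0}} (ℕ.m≤n⇒m≤1+n n≤k))

module _ (a n : ℕ) .{{_ : NonZero n}} {x : ℕ → ℚ} where
  private
    open ≤-Reasoning
    q = n ^ᶻ (+ 2 ℤ.- + a)

  -- Halving c compensates for the factor 2ᵃ in `√-seq≤scale`.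
  scale≤⇒√≤ᴿ : ∀ {c} → 0ℚ < c → (∀ k → n ℕ.≤ k → c ^ a * scale a n ≤ x k) →
    ∀ ε → 0ℚ < ε → ∃ λ N → ∀ k → N ℕ.≤ k → (½ * c) ^ a * √-seq q k ≤ x k + ε
  scale≤⇒√≤ᴿ {c} 0<c h ε 0<ε = n , λ k n≤k → begin
    (½ * c) ^ a * √-seq q k                 ≤⟨ *-monoˡ (0≤^ (<⇒≤ (0<* 0<½ 0<c)) a) (√-seq≤scale a n k) ⟩
    (½ * c) ^ a * (ι 2 ^ a * scale a n)     ≡⟨ sym (*-assoc ((½ * c) ^ a) (ι 2 ^ a) (scale a n)) ⟩
    (½ * c) ^ a * ι 2 ^ a * scale a n       ≡⟨ cong (_* scale a n) (sym (^-distrib-* (½ * c) (ι 2) a)) ⟩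
    (½ * c * ι 2) ^ a * scale a n           ≡⟨ cong (λ d → d ^ a * scale a n) (solve 1 (λ c → con ½ :* c :* con (ι 2) := c) refl c) ⟩
    c ^ a * scale a n                       ≤⟨ h k n≤k ⟩
    x k                                     ≤⟨ ≤-slack (<⇒≤ 0<ε) refl ⟩
    x k     + ε                             ∎

  -- The constant C is kept; the rounding error C/(k+1) drops below ε once k reaches the denominator
  -- of δ.
  ≤scale⇒≤ᴿ√ : ∀ {C} → 0ℚ < C → (∀ k → n ℕ.≤ k → x k ≤ C * scale a n) →
    ∀ ε → 0ℚ < ε → ∃ λ N → ∀ k → N ℕ.≤ k → x k ≤ C * √-seq q k + ε
  ≤scale⇒≤ᴿ√ {C} 0<C h ε 0<ε =
    let δ , 0<δ , Cδ≤ε = divide C ε (<⇒≤ 0<C) 0<ε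
    in n ℕ.⊔ ↧ₙ δ , λ k N≤k → begin
    x k                                         ≤⟨ h k (ℕ.m⊔n≤o⇒m≤o n (↧ₙ δ) N≤k) ⟩
    C * scale a n                               ≤⟨ *-monoˡ (<⇒≤ 0<C) (scale≤√-seq a n k) ⟩
    C * (√-seq q k + + 1 / suc k)               ≡⟨ *-distribˡ-+ C (√-seq q k) (+ 1 / suc k) ⟩
    C * √-seq q k + C * (+ 1 / suc k)           ≤⟨ +-monoʳ-≤ (C * √-seq q k) (≤-trans
                                                     (*-monoˡ (<⇒≤ 0<C) (√-Bounds.1/-≤ q 0<δ k (ℕ.m⊔n≤o⇒n≤o n (↧ₙ δ) N≤k))) Cδ≤ε) ⟩
    C * √-seq q k + ε                           ∎

theorem3 : (a : ℕ) → 2 ∤ a →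
    (λ n → ∑ᴿ λ i → E (λ u → ∣ X i u - t n i ∣ ^ a) (displacement-continuous a i))
    ∈Θ (λ n → n ^[ + 2 ℤ.- + a /2])
theorem3 a 2∤a =
  let m , a≡1+2m = odd a 2∤a
      2+2m≡ = trans (cong suc a≡1+2m) (cong suc (sym (ℕ.+-suc m m)))
  -- Both bounds hold for every positive n, hence n₀ = 0; n only decides from which term on the
  -- sequences are compared. With a = 2m + 1, the even exponent a + 1 is 2(m+1).
  in (½ * lowerConstant) ^ a , upperConstant a (suc m) , 0 ,
     0<^ (0<* 0<½ 0<lowerConstant) a , 0<upperConstant a (suc m) ,
     λ n {{n≢0}} _ →
       scale≤⇒√≤ᴿ a n {{n≢0}} 0<lowerConstant (seq-displacement≥ a (m ℕ.+ m) a≡1+2m n {{n≢0}}) ,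
       ≤scale⇒≤ᴿ√ a n {{n≢0}} (0<upperConstant a (suc m)) (seq-displacement≤ a (suc m) 2+2m≡ n {{n≢0}})
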